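{- Let $k$ and $n$ be positive integers. For $m\in\{0,1,2\}$, we have $$u_m(n)=\sum_{j=0}^{\infty}C_m\big(n+k(3k+1)/2-j\big)\,\big(M_k(j)+\widetilde{P}_k(j)\big).$$
   Context: Unimodal compositions. A composition of a positive integer $n$ is a sequence $(\lambda_1,\ldots,\lambda_r)$ of positive integers (parts) with sum $n$. It is unimodal if there exists $t\in\{1,\ldots,r\}$ with $\lambda_1\leqslant\cdots\leqslant\lambda_t$ and $\lambda_t\geqslant\cdots\geqslant\lambda_r$. For $n\geqslant 1$, $u_0(n)$ is the number of unimodal compositions of $n$. For $m\geqslant1$ and $n\geqslant0$, $u_m(n)$ is the number of unimodal compositions of $n+m$ in which the maximal part appears exactly $m$ times. Crank. For a partition $\lambda=(\lambda_1\geqslant\lambda_2\geqslant\cdots)$, let $\omega(\lambda)$ be the number of parts of $\lambda$ equal to $1$, and $\mu(\lambda)$ the number of parts of $\lambda$ larger than $\omega(\lambda)$. The crank is $c(\lambda)=\lambda_1$ (the largest part) if $\omega(\lambda)=0$, and $c(\lambda)=\mu(\lambda)-\omega(\lambda)$ if $\omega(\lambda)>0$. The empty partition of $0$ has crank $0$. For a non-negative integer $n\neq1$: $C_0(n)$ is the number of partitions $\lambda$ of $n$ with $c(\lambda)>0$; $C_1(n)$ is the number of partitions $\lambda$ of $n$ with $c(\lambda)\geqslant0$; $C_2(n)$ is the number of partitions $\lambda$ of $n$ with $c(\lambda)=0$. Thus $C_0(0)=0$ and $C_1(0)=C_2(0)=1$. Moreover, by definition, $C_0(1)=1$, $C_1(1)=0$,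 $C_2(1)=-1$. Convention: $C_m(n)=0$ for $n<0$ (so the sum over $j$ is finite). $M_k(n)$ (for $k\geqslant 1$, $n\geqslant 0$) is the number of partitions of $n$ in which $k$ is the least positive integer that is not a part and there are more parts $>k$ than there are parts $<k$ (parts counted with multiplicity); in particular $M_k(0)=0$. $\widetilde{P}_k(n)$ (for $k\geqslant 1$, $n\geqslant 0$) is the number of partitions of $n$ in which every integer $1,2,\ldots,k$ appears as a part at least once, and the first part larger than $k$ (i.e. the smallest part among the parts exceeding $k$, which is required to exist) appears at least $k+1$ times; in particular $\widetilde{P}_k(0)=0$. -}

module Defs where

open import Data.Empty using (⊥)
open import Data.Fin using (Fin; toℕ) renaming (zero to fzero; suc to fsuc)
import Data.Fin.Properties as Fin
open import Data.Integer as ℤ using (ℤ; +_; -[1+_]; -1ℤ)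
import Data.Integer.Properties as ℤ
open import Data.List using (List; []; _∷_; _++_; map; filter; length; take; drop)
open import Data.List.Extrema.Nat using (max)
open import Data.List.Membership.Propositional using (_∈_; _∉_)
open import Data.List.Membership.Propositional.Properties
  using (∈-map⁺; ∈-map⁻; ∈-++⁺ˡ; ∈-++⁺ʳ)
import Data.List.Properties as List
open import Data.List.Relation.Unary.All as All using (All; []; _∷_)
import Data.List.Relation.Unary.All.Properties as All
open import Data.List.Relation.Unary.Any as Any using (here)
open import Data.List.Relation.Unary.Linked using (Linked; linked?)
open import Data.List.Relation.Unary.Unique.Propositional using (Unique; []; _∷_)
import Data.List.Relation.Unary.Unique.Propositional.Properties as Unique
open import Data.Nat
  using (ℕ; zero; suc; _+_; _≤_; _<_; _≥_; _>_; z≤n; s≤s; _≟_; _≤?_; _<?_; _≥?_; _>?_)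
open import Data.Nat.ListAction using (sum)
open import Data.Nat.Properties using (allUpTo?; suc-injective)
open import Data.List.Membership.DecPropositional _≟_ using (_∈?_; _∉?_)
open import Data.Product using (∃-syntax; _×_; _,_)
open import Function using (_⇔_; mk⇔)
open import Relation.Binary.PropositionalEquality using (_≡_; refl; cong)
open import Relation.Nullary.Decidable using (_×-dec_; _→-dec_)
open import Relation.Unary using (Pred; Decidable)

count : ∀ {a p} {A : Set a} {P : Pred A p} → Decidable P → List A → ℕ
count P? xs = length (filter P? xs)

multiplicity : ℕ → List ℕ → ℕ
multiplicity x = count (_≟ x)

-- The empty list gets 0, which makes the crank of the empty partition 0.
largest : List ℕ → ℕ
largest = max 0

_CompositionOf_ : List ℕ → ℕ → Set
c CompositionOf n = All (1 ≤_) c × sum c ≡ n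

-- Every composition of n + 2 either has first part 1, followed by a composition
-- of n + 1, or arises from a composition of n + 1 by increasing the first part.
increaseHead : List ℕ → List ℕ
increaseHead []       = []
increaseHead (x ∷ xs) = suc x ∷ xs

compositions : ℕ → List (List ℕ)
compositions zero          = [] ∷ []
compositions (suc zero)    = (1 ∷ []) ∷ []
compositions (suc (suc n)) =
  map (1 ∷_) (compositions (suc n)) ++ map increaseHead (compositions (suc n))

compositions-sound : ∀ n → All (_CompositionOf n) (compositions n)
compositions-sound zero          = ([] , refl) ∷ []
compositions-sound (suc zero)    = (s≤s z≤n ∷ [] , refl) ∷ []
compositions-sound (suc (suc n)) =
  All.++⁺ (All.map⁺ (All.map prepend (compositions-sound (suc n))))
          (All.map⁺ (All.map increase (compositions-sound (suc n))))
  where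
  prepend : ∀ {c} → c CompositionOf suc n → (1 ∷ c) CompositionOf suc (suc n)
  prepend (pos , eq) = s≤s z≤n ∷ pos , cong suc eq

  increase : ∀ {c} → c CompositionOf suc n → increaseHead c CompositionOf suc (suc n)
  increase {_ ∷ _} (_ ∷ pos , eq) = s≤s z≤n ∷ pos , cong suc eq

compositions-complete : ∀ n {c} → c CompositionOf n → c ∈ compositions n
compositions-complete zero       {[]}                 _            = here refl
compositions-complete zero       {zero ∷ _}           (() ∷ _ , _)
compositions-complete (suc zero) {suc zero ∷ []}      _            = here refl
compositions-complete (suc zero) {suc zero ∷ zero ∷ _} (_ ∷ () ∷ _ , _)
compositions-complete (suc n)    {zero ∷ _}           (() ∷ _ , _)
compositions-complete (suc (suc n)) {suc zero ∷ xs} (_ ∷ pos , eq) =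
  ∈-++⁺ˡ (∈-map⁺ (1 ∷_) (compositions-complete (suc n) (pos , suc-injective eq)))
compositions-complete (suc (suc n)) {suc (suc x) ∷ xs} (_ ∷ pos , eq) =
  ∈-++⁺ʳ (map (1 ∷_) (compositions (suc n)))
    (∈-map⁺ increaseHead
      (compositions-complete (suc n) {suc x ∷ xs} (s≤s z≤n ∷ pos , suc-injective eq)))

∈-compositions : ∀ n {c} → c ∈ compositions n ⇔ c CompositionOf n
∈-compositions n = mk⇔ (All.lookup (compositions-sound n)) (compositions-complete n)

increaseHead-injective : ∀ {c d} → increaseHead c ≡ increaseHead d → c ≡ d
increaseHead-injective {[]}    {[]}    refl = refl
increaseHead-injective {_ ∷ _} {_ ∷ _} refl = refl

compositions-unique : ∀ n → Unique (compositions n)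
compositions-unique zero          = [] ∷ []
compositions-unique (suc zero)    = [] ∷ []
compositions-unique (suc (suc n)) =
  Unique.++⁺
    (Unique.map⁺ List.∷-injectiveʳ (compositions-unique (suc n)))
    (Unique.map⁺ increaseHead-injective (compositions-unique (suc n)))
    disjoint
  where
  disjoint : ∀ {c} → c ∈ map (1 ∷_) (compositions (suc n)) ×
                     c ∈ map increaseHead (compositions (suc n)) → ⊥
  disjoint (c∈₁ , c∈₂) with ∈-map⁻ (1 ∷_) c∈₁ | ∈-map⁻ increaseHead c∈₂
  ... | _ , _ , refl | zero ∷ _ , e∈ , _ with All.lookup (compositions-sound (suc n)) e∈
  ...   | () ∷ _ , _

-- The index t counts from 0.
Unimodal : List ℕ → Set
Unimodal c = ∃[ t ] Linked _≤_ (take (suc (toℕ {length c} t)) c)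
                  × Linked _≥_ (drop (toℕ t) c)

unimodal? : Decidable Unimodal
unimodal? c = Fin.any? λ t →
  linked? _≤?_ (take (suc (toℕ t)) c) ×-dec linked? _≥?_ (drop (toℕ t) c)

-- Since the empty composition has no index t, u 0 0 = 0; mathematically u₀(n) is
-- only defined for n ≥ 1.
u : ℕ → ℕ → ℕ
u zero      n = count unimodal? (compositions n)
u m@(suc _) n =
  count (λ c → unimodal? c ×-dec (multiplicity (largest c) c ≟ m)) (compositions (n + m))

partitions : ℕ → List (List ℕ)
partitions n = filter (linked? _≥?_) (compositions n)

ω : List ℕ → ℕ
ω = multiplicity 1

μ : List ℕ → ℕ
μ p = count (_>? ω p) p

crank : List ℕ → ℤ
crank p with ω p
... | zero  = + largest p
... | suc w = + μ p ℤ.- + suc w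

-- Apart from the conventional values at negative integers and at 1, the number of
-- partitions of n whose crank is positive, nonnegative, zero, respectively.
C : Fin 3 → ℤ → ℤ
C m                       -[1+ _ ] = + 0
C fzero                   (+ 1)    = + 1
C (fsuc fzero)            (+ 1)    = + 0
C (fsuc (fsuc fzero))     (+ 1)    = -1ℤ
C fzero                   (+ n)    = + count (λ p → + 0 ℤ.<? crank p) (partitions n)
C (fsuc fzero)            (+ n)    = + count (λ p → + 0 ℤ.≤? crank p) (partitions n)
C (fsuc (fsuc fzero))     (+ n)    = + count (λ p → crank p ℤ.≟ + 0) (partitions n)

AllBelowAreParts : ℕ → List ℕ → Set
AllBelowAreParts k p = ∀ {i} → i < k → 1 ≤ i → i ∈ p

allBelowAreParts? : ∀ k → Decidable (AllBelowAreParts k)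
allBelowAreParts? k p = allUpTo? (λ i → (1 ≤? i) →-dec (i ∈? p)) k

LeastNonPart : ℕ → List ℕ → Set
LeastNonPart k p = 1 ≤ k × k ∉ p × AllBelowAreParts k p

leastNonPart? : ∀ k → Decidable (LeastNonPart k)
leastNonPart? k p = (1 ≤? k) ×-dec (k ∉? p) ×-dec allBelowAreParts? k p

M : ℕ → ℕ → ℕ
M k n =
  count (λ p → leastNonPart? k p ×-dec (count (_>? k) p >? count (_<? k) p)) (partitions n)

-- For s a part of p: s is the smallest part of p exceeding k.
SmallestPartAbove : ℕ → List ℕ → ℕ → Set
SmallestPartAbove k p s = k < s × All (λ x → k < x → s ≤ x) p

smallestPartAbove? : ∀ k p → Decidable (SmallestPartAbove k p)
smallestPartAbove? k p s = (k <? s) ×-dec All.all? (λ x → (k <? x) →-dec (s ≤? x)) p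

P̃ : ℕ → ℕ → ℕ
P̃ k n =
  count
    (λ p → allBelowAreParts? (suc k) p
       ×-dec Any.any? (λ s → smallestPartAbove? k p s ×-dec (multiplicity s p ≥? suc k)) p)
    (partitions n)

partialSum : (ℕ → ℤ) → ℕ → ℤ
partialSum f zero    = + 0
partialSum f (suc N) = partialSum f N ℤ.+ f N

-- f 0 + f 1 + f 2 + ⋯ = s for a series of integers: the partial sums are
-- eventually constant, equal to s.
HasSum : (ℕ → ℤ) → ℤ → Set
HasSum f s = ∃[ N ] ∀ N′ → N ≤ N′ → partialSum f N′ ≡ s

{-# OPTIONS --safe #-}

-- Write (q)_l = (1 − q)⋯(1 − q^l), let a l = 1/(q)_l, and let G t be the generating function of
-- the partitions with all parts > t, so that G 0 is that of all partitions. The theorem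
-- follows from two identities of power series:
--
--   ∑ (M k n + P̃ k n) q^n = q^(k(3k+1)/2) G 0    and    U_m = C_m G 0,
--
-- where U_m and C_m are the generating functions of u m and of C m.
--
-- For the first, M k has generating function q^(k(k−1)/2) ∑_{t ≥ k} q^((t+1)k) a (k−1) G t, by the
-- q-binomial theorem in the form a (l + j) · [l+j choose j] = a l · a j. Together with that of
-- P̃ k, a sum over t too, it telescopes, because G t = G (t+1) + q^(t+1) G t.
--
-- For the second, partitions with w ones and m parts larger than w have generating function
-- (1 − q) q^(w + m + wm) a w · a m; with the values of C at 1, this is right for w = 0 as well, with m
-- the largest part. Splitting off a rectangle,
--
--   a w · a (w + d) = ∑_{i + j = w} q^(i(i+d)) a j · a i · a (i + d),
--
-- trades the factor q^(wm), after summation, for a factor 1/G 1 = 1/((1 − q) G 0). What remains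
-- counts pairs of partitions with largest parts w and m. For m − w > 0, ≥ 0, = 0 these are the
-- unimodal compositions counted by u 0, u 1, u 2: the two partitions lie on either side of the peak.
--
-- All series have coefficients in ℕ, so the identities are stated without subtraction.
module Submission where

open import Defs
open import Algebra using (CommutativeSemiring)
import Algebra.Solver.Ring.NaturalCoefficients.Default as SemiringSolver
import Algebra.Structures.Biased as Biased
open import Data.Fin using (Fin; toℕ) renaming (zero to fzero; suc to fsuc)
open import Data.Fin.Properties using (0↔⊥; 1↔⊤; +↔⊎; *↔×)
open import Data.List
  using (List; []; _∷_; _++_; _ʳ++_; map; filter; length; replicate; reverse; allFin; take; drop)
open import Data.List.Extrema.Nat using (xs≤max; max≤v⁺)
open import Data.List.Membership.Propositional using (_∈_; _∉_; find; lose)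
open import Data.List.Membership.Propositional.Properties
open import Data.List.Membership.Propositional.Properties.WithK using (unique∧set⇒bag)
open import Data.List.Properties hiding (sum-++)
open import Data.List.Relation.Binary.BagAndSetEquality using (∼bag⇒↭)
open import Data.List.Relation.Binary.Permutation.Propositional using (↭-sym)
open import Data.List.Relation.Binary.Permutation.Propositional.Properties
  using (All-resp-↭; ↭-length; ↭-reverse)
open import Data.List.Relation.Unary.All as All using (All; []; _∷_)
import Data.List.Relation.Unary.All.Properties as All
open import Data.List.Relation.Unary.AllPairs using (AllPairs; []; _∷_)
import Data.List.Relation.Unary.AllPairs.Properties as AllPairs
open import Data.List.Relation.Unary.Any as Any using (here; there)
import Data.List.Relation.Unary.Any.Properties as Any
open import Data.List.Relation.Unary.Linked using (Linked; linked?)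
open import Data.List.Relation.Unary.Linked.Properties using (AllPairs⇒Linked; Linked⇒AllPairs)
open import Data.List.Relation.Unary.Unique.Propositional using (Unique)
import Data.List.Relation.Unary.Unique.Propositional.Properties as Unique
open import Data.Nat
  using (ℕ; zero; suc; _+_; _*_; _∸_; _/_; _≤_; _<_; _≥_; _>_; z≤n; s≤s; s≤s⁻¹; _≟_; _<?_; _>?_; _≥?_)
open import Data.Nat.DivMod using (m*n/n≡m)
open import Data.Nat.ListAction using (sum)
open import Data.Nat.ListAction.Properties using (sum-++; sum-↭)
open import Data.Nat.Properties
open import Data.Nat.Tactic.RingSolver using (solve-∀)
open import Data.Product using (Σ; ∃; ∃-syntax; _×_; _,_; proj₁; proj₂; map₁)
open import Data.Product.Function.NonDependent.Propositional using (_×-↔_)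
open import Data.Sum using (_⊎_; inj₁; inj₂; [_,_]′)
open import Data.Sum.Function.Propositional using (_⊎-↔_)
open import Data.Unit using (⊤; tt)
open import Data.Vec as Vec using (Vec; []; _∷_)
open import Function using (_∘_; flip; _↔_; mk↔ₛ′; mk⇔; Inverse)
open import Function.Properties.Inverse using (↔-sym; ↔-trans)
open import Relation.Binary using (IsEquivalence)
open import Relation.Binary.PropositionalEquality hiding (setoid; [_])
import Relation.Binary.Reasoning.Setoid as SetoidReasoning
open import Relation.Nullary using (¬_; yes; no; contradiction)
open import Relation.Nullary.Decidable using (_×-dec_)
open import Relation.Unary using (Decidable)

-- Power series with natural coefficients

-- ∑⟨ f ⟩ n is the sum of the f i j with i + j = n.
∑⟨_⟩ : (ℕ → ℕ → ℕ) → ℕ → ℕ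
∑⟨ f ⟩ zero    = f 0 0
∑⟨ f ⟩ (suc n) = f 0 (suc n) + ∑⟨ (λ i j → f (suc i) j) ⟩ n

∑-cong : ∀ {f g} n → (∀ i j → i + j ≡ n → f i j ≡ g i j) → ∑⟨ f ⟩ n ≡ ∑⟨ g ⟩ n
∑-cong zero    eq = eq 0 0 refl
∑-cong (suc n) eq =
  cong₂ _+_ (eq 0 (suc n) refl) (∑-cong n λ i j p → eq (suc i) j (cong suc p))

∑-+ : ∀ f g n → ∑⟨ (λ i j → f i j + g i j) ⟩ n ≡ ∑⟨ f ⟩ n + ∑⟨ g ⟩ n
∑-+ f g zero    = refl
∑-+ f g (suc n) = trans (cong (f 0 (suc n) + g 0 (suc n) +_) (∑-+ (f ∘ suc) (g ∘ suc) n))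
  (interchange (f 0 (suc n)) (g 0 (suc n)) (∑⟨ f ∘ suc ⟩ n) (∑⟨ g ∘ suc ⟩ n))
  where
  interchange : ∀ a b c d → a + b + (c + d) ≡ a + c + (b + d)
  interchange = solve-∀

∑-*ˡ : ∀ c f n → ∑⟨ (λ i j → c * f i j) ⟩ n ≡ c * ∑⟨ f ⟩ n
∑-*ˡ c f zero    = refl
∑-*ˡ c f (suc n) = trans (cong (c * f 0 (suc n) +_) (∑-*ˡ c (f ∘ suc) n))
                         (sym (*-distribˡ-+ c (f 0 (suc n)) _))

∑-*ʳ : ∀ c f n → ∑⟨ (λ i j → f i j * c) ⟩ n ≡ ∑⟨ f ⟩ n * c
∑-*ʳ c f n = trans (∑-cong n λ i j _ → *-comm (f i j) c)
                   (trans (∑-*ˡ c f n) (*-comm c _))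

∑-zero : ∀ n → ∑⟨ (λ _ _ → 0) ⟩ n ≡ 0
∑-zero zero    = refl
∑-zero (suc n) = ∑-zero n

∑-sucʳ : ∀ f n → ∑⟨ f ⟩ (suc n) ≡ ∑⟨ (λ i j → f i (suc j)) ⟩ n + f (suc n) 0
∑-sucʳ f zero    = refl
∑-sucʳ f (suc n) = trans (cong (f 0 (suc (suc n)) +_) (∑-sucʳ (f ∘ suc) n))
                         (sym (+-assoc (f 0 (suc (suc n))) _ _))

∑-comm : ∀ f n → ∑⟨ (λ i j → f j i) ⟩ n ≡ ∑⟨ f ⟩ n
∑-comm f zero    = refl
∑-comm f (suc n) = trans (cong (f (suc n) 0 +_) (∑-comm (λ i j → f i (suc j)) n))
  (trans (+-comm (f (suc n) 0) _) (sym (∑-sucʳ f n)))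

-- Both sides run over the triples with `i + j + r = n`. This serves associativity of the product as
-- well as the rearranged double sums in `D-⊛` and `D-assoc`.
∑-assoc : ∀ (h : ℕ → ℕ → ℕ → ℕ) n →
  ∑⟨ (λ k r → ∑⟨ (λ i j → h i j r) ⟩ k) ⟩ n ≡ ∑⟨ (λ i s → ∑⟨ h i ⟩ s) ⟩ n
∑-assoc h zero    = refl
∑-assoc h (suc n) = begin
  h 0 0 (suc n) + ∑⟨ (λ k r → h 0 (suc k) r + ∑⟨ (λ i j → h (suc i) j r) ⟩ k) ⟩ n
    ≡⟨ cong (h 0 0 (suc n) +_) (∑-+ (h 0 ∘ suc) _ n) ⟩
  h 0 0 (suc n) + (∑⟨ h 0 ∘ suc ⟩ n + ∑⟨ (λ k r → ∑⟨ (λ i j → h (suc i) j r) ⟩ k) ⟩ n)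
    ≡⟨ +-assoc (h 0 0 (suc n)) _ _ ⟨
  ∑⟨ h 0 ⟩ (suc n) + ∑⟨ (λ k r → ∑⟨ (λ i j → h (suc i) j r) ⟩ k) ⟩ n
    ≡⟨ cong (∑⟨ h 0 ⟩ (suc n) +_) (∑-assoc (h ∘ suc) n) ⟩
  ∑⟨ h 0 ⟩ (suc n) + ∑⟨ (λ i s → ∑⟨ h (suc i) ⟩ s) ⟩ n ∎
  where open ≡-Reasoning

infixl 7 _⊛_
infixl 6 _⊕_
infix 4 _≈_

-- A record rather than a bare function, so that sums and products of series stay folded until a
-- coefficient is taken.
record Series : Set where
  no-eta-equality
  field coeff : ℕ → ℕ
open Series public

record _≈_ (f g : Series) : Set where
  constructor pointwise
  field at : ∀ n → coeff f n ≡ coeff g n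
open _≈_ public

≈-isEquivalence : IsEquivalence _≈_
≈-isEquivalence = record
  { refl  = pointwise λ _ → refl
  ; sym   = λ p → pointwise λ n → sym (at p n)
  ; trans = λ p q → pointwise λ n → trans (at p n) (at q n) }

𝟘 𝟙 : Series
coeff 𝟘 _ = 0
coeff 𝟙 zero = 1
coeff 𝟙 (suc _) = 0

_⊕_ _⊛_ : Series → Series → Series
coeff (f ⊕ g) n = coeff f n + coeff g n
coeff (f ⊛ g) n = ∑⟨ (λ i j → coeff f i * coeff g j) ⟩ n

q·_ : Series → Series
coeff (q· f) zero    = 0
coeff (q· f) (suc n) = coeff f n

q^ : ℕ → Series
q^ zero    = 𝟙
q^ (suc t) = q· q^ t

seriesSemiring : CommutativeSemiring _ _
seriesSemiring = record
  { Carrier = Series ; _≈_ = _≈_ ; _+_ = _⊕_ ; _*_ = _⊛_ ; 0# = 𝟘 ; 1# = 𝟙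
  ; isCommutativeSemiring = Biased.isCommutativeSemiringˡ record
    { +-isCommutativeMonoid = Biased.isCommutativeMonoidˡ record
      { isSemigroup = record
        { isMagma = record
          { isEquivalence = ≈-isEquivalence
          ; ∙-cong = λ p q → pointwise λ n → cong₂ _+_ (at p n) (at q n) }
        ; assoc = λ f g h → pointwise λ n → +-assoc (coeff f n) _ _ }
      ; identityˡ = λ f → pointwise λ n → refl
      ; comm = λ f g → pointwise λ n → +-comm (coeff f n) _ }
    ; *-isCommutativeMonoid = Biased.isCommutativeMonoidˡ record
      { isSemigroup = record
        { isMagma = record
          { isEquivalence = ≈-isEquivalence
          ; ∙-cong = λ p q → pointwise λ n →
              ∑-cong n λ i j _ → cong₂ _*_ (at p i) (at q j) }
        ; assoc = ⊛-assoc }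
      ; identityˡ = ⊛-identityˡ
      ; comm = λ f g → pointwise λ n →
          trans (∑-cong n λ i j _ → *-comm (coeff f i) (coeff g j)) (∑-comm _ n) }
    ; distribʳ = λ f g h → pointwise λ n →
        trans (∑-cong n λ i j _ → *-distribʳ-+ (coeff f j) (coeff g i) _) (∑-+ _ _ n)
    ; zeroˡ = λ f → pointwise ∑-zero } }
  where
  ⊛-identityˡ : ∀ f → 𝟙 ⊛ f ≈ f
  ⊛-identityˡ f = pointwise λ where
    zero    → +-identityʳ _
    (suc n) → trans (cong₂ _+_ (+-identityʳ _) (∑-zero n)) (+-identityʳ _)

  ⊛-assoc : ∀ f g h → f ⊛ g ⊛ h ≈ f ⊛ (g ⊛ h)
  ⊛-assoc f g h = pointwise λ n → trans
    (∑-cong n λ k r _ → sym (∑-*ʳ (coeff h r) _ k))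
    (trans (∑-assoc (λ i j r → coeff f i * coeff g j * coeff h r) n)
           (∑-cong n λ i s _ →
             trans (∑-cong s λ j r _ → *-assoc (coeff f i) _ _) (∑-*ˡ (coeff f i) _ s)))

open CommutativeSemiring seriesSemiring public
  using (setoid)
  renaming ( refl to ≈-refl; sym to ≈-sym; trans to ≈-trans; reflexive to ≈-reflexive
           ; +-cong to ⊕-cong; *-cong to ⊛-cong; +-congˡ to ⊕-congˡ; +-congʳ to ⊕-congʳ
           ; *-congˡ to ⊛-congˡ; *-congʳ to ⊛-congʳ; *-comm to ⊛-comm; *-assoc to ⊛-assoc
           ; distribˡ to ⊛-distribˡ; zeroˡ to ⊛-zeroˡ; zeroʳ to ⊛-zeroʳ
           ; *-identityˡ to ⊛-identityˡ; +-identityˡ to ⊕-identityˡ; +-comm to ⊕-comm)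

open SemiringSolver seriesSemiring using (solve; _:=_; _:+_; _:*_; con)
module ≈-Reasoning = SetoidReasoning setoid

⊕-cancelʳ : ∀ {f g h} → f ⊕ h ≈ g ⊕ h → f ≈ g
⊕-cancelʳ p = pointwise λ n → +-cancelʳ-≡ _ _ _ (at p n)

q·-cong : ∀ {f g} → f ≈ g → q· f ≈ q· g
q·-cong p = pointwise λ { zero → refl ; (suc n) → at p n }

q·-⊛ : ∀ f g → (q· f) ⊛ g ≈ q· (f ⊛ g)
q·-⊛ f g = pointwise λ { zero → refl ; (suc n) → refl }

q·-q^ : ∀ f → q· f ≈ q^ 1 ⊛ f
q·-q^ f = ≈-sym (≈-trans (q·-⊛ 𝟙 f) (q·-cong (⊛-identityˡ f)))

q^-+ : ∀ s t → q^ (s + t) ≈ q^ s ⊛ q^ t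
q^-+ zero    t = ≈-sym (⊛-identityˡ (q^ t))
q^-+ (suc s) t = ≈-trans (q·-cong (q^-+ s t)) (≈-sym (q·-⊛ (q^ s) (q^ t)))

q^-≡ : ∀ {r} s t → r ≡ s + t → q^ r ≈ q^ s ⊛ q^ t
q^-≡ s t refl = q^-+ s t

q^-≡₃ : ∀ {u} r s t → u ≡ r + s + t → q^ u ≈ q^ r ⊛ q^ s ⊛ q^ t
q^-≡₃ r s t refl = ≈-trans (q^-+ (r + s) t) (⊛-congʳ (q^-+ r s))

q^-low : ∀ t f {n} → n < t → coeff (q^ t ⊛ f) n ≡ 0
q^-low (suc t) f {zero}  _         = refl
q^-low (suc t) f {suc n} (s≤s n<t) = q^-low t f n<t

-- D F is the sum over i of q^i F_i.
D : (ℕ → Series) → Series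
coeff (D F) n = ∑⟨ (λ i j → coeff (F i) j) ⟩ n

D-cong : ∀ {F G} → (∀ i → F i ≈ G i) → D F ≈ D G
D-cong p = pointwise λ n → ∑-cong n λ i j _ → at (p i) j

D-⊕ : ∀ F G → D (λ i → F i ⊕ G i) ≈ D F ⊕ D G
D-⊕ F G = pointwise λ n → ∑-+ _ _ n

-- Shifting the index costs a factor q because `D` itself supplies the power q^i. For the same
-- reason, exponents written under `D` are smaller by the index than the total exponents.
D-suc : ∀ F → D F ≈ F 0 ⊕ q^ 1 ⊛ D (F ∘ suc)
D-suc F = ≈-trans (pointwise λ { zero → sym (+-identityʳ _) ; (suc n) → refl })
                  (⊕-congˡ (q·-q^ (D (F ∘ suc))))

∑ₛ : (ℕ → ℕ → Series) → ℕ → Series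
coeff (∑ₛ F k) r = ∑⟨ (λ i j → coeff (F i j) r) ⟩ k

∑ₛ-cong : ∀ {F G} n → (∀ i j → i + j ≡ n → F i j ≈ G i j) → ∑ₛ F n ≈ ∑ₛ G n
∑ₛ-cong n p = pointwise λ r → ∑-cong n λ i j e → at (p i j e) r

∑ₛ-⊕ : ∀ F G n → ∑ₛ (λ i j → F i j ⊕ G i j) n ≈ ∑ₛ F n ⊕ ∑ₛ G n
∑ₛ-⊕ F G n = pointwise λ r → ∑-+ _ _ n

∑ₛ-suc : ∀ F n → ∑ₛ F (suc n) ≈ F 0 (suc n) ⊕ ∑ₛ (λ i j → F (suc i) j) n
∑ₛ-suc F n = pointwise λ r → refl

∑ₛ-sucʳ : ∀ F n → ∑ₛ F (suc n) ≈ ∑ₛ (λ i j → F i (suc j)) n ⊕ F (suc n) 0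
∑ₛ-sucʳ F n = pointwise λ r → ∑-sucʳ (λ i j → coeff (F i j) r) n

∑ₛ-zero : ∀ F → ∑ₛ F 0 ≈ F 0 0
∑ₛ-zero F = pointwise λ r → refl

∑ₛ-⊛ : ∀ f G n → ∑ₛ (λ i j → f ⊛ G i j) n ≈ f ⊛ ∑ₛ G n
∑ₛ-⊛ f G zero    = ≈-trans (∑ₛ-zero _) (⊛-congˡ (≈-sym (∑ₛ-zero G)))
∑ₛ-⊛ f G (suc n) = begin
  ∑ₛ (λ i j → f ⊛ G i j) (suc n)          ≈⟨ ∑ₛ-suc _ n ⟩
  f ⊛ G 0 (suc n) ⊕ ∑ₛ (λ i j → f ⊛ G (suc i) j) n ≈⟨ ⊕-congˡ (∑ₛ-⊛ f (G ∘ suc) n) ⟩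
  f ⊛ G 0 (suc n) ⊕ f ⊛ ∑ₛ (G ∘ suc) n    ≈⟨ ⊛-distribˡ f _ _ ⟨
  f ⊛ (G 0 (suc n) ⊕ ∑ₛ (G ∘ suc) n)      ≈⟨ ⊛-congˡ (∑ₛ-suc G n) ⟨
  f ⊛ ∑ₛ G (suc n)                        ∎
  where open ≈-Reasoning

D-⊛ : ∀ f G → D (λ i → f ⊛ G i) ≈ f ⊛ D G
D-⊛ f G = pointwise λ n → begin
  ∑⟨ (λ i j → ∑⟨ (λ a b → coeff f a * coeff (G i) b) ⟩ j) ⟩ n
    ≡⟨ ∑-assoc (λ i a b → coeff f a * coeff (G i) b) n ⟨
  ∑⟨ (λ k b → ∑⟨ (λ i a → coeff f a * coeff (G i) b) ⟩ k) ⟩ n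
    ≡⟨ ∑-cong n (λ k b _ → ∑-comm (λ a i → coeff f a * coeff (G i) b) k) ⟩
  ∑⟨ (λ k b → ∑⟨ (λ a i → coeff f a * coeff (G i) b) ⟩ k) ⟩ n
    ≡⟨ ∑-assoc (λ a i b → coeff f a * coeff (G i) b) n ⟩
  ∑⟨ (λ a s → ∑⟨ (λ i b → coeff f a * coeff (G i) b) ⟩ s) ⟩ n
    ≡⟨ ∑-cong n (λ a s _ → ∑-*ˡ (coeff f a) _ s) ⟩
  ∑⟨ (λ a s → coeff f a * ∑⟨ (λ i b → coeff (G i) b) ⟩ s) ⟩ n ∎
  where open ≡-Reasoning

-- The weight q^k of the antidiagonal `i + j = k` factors as q^i q^j.
D-assoc : ∀ F → D (∑ₛ F) ≈ D (λ i → D (F i))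
D-assoc F = pointwise λ n → ∑-assoc (λ i j → coeff (F i j)) n

D-product : ∀ F G → D F ⊛ D G ≈ D (∑ₛ λ i j → F i ⊛ G j)
D-product F G = begin
  D F ⊛ D G                       ≈⟨ ⊛-comm _ _ ⟩
  D G ⊛ D F                       ≈⟨ D-⊛ (D G) F ⟨
  D (λ i → D G ⊛ F i)             ≈⟨ D-cong (λ i → ≈-trans (⊛-comm _ _) (≈-sym (D-⊛ (F i) G))) ⟩
  D (λ i → D (λ j → F i ⊛ G j))   ≈⟨ D-assoc (λ i j → F i ⊛ G j) ⟨
  D (∑ₛ λ i j → F i ⊛ G j)        ∎
  where open ≈-Reasoning

-- Durfee rectangles

-- geo t = 1/(1 − q^(t+1))
geo : ℕ → Series
geo t = D (λ i → q^ (i * t))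

geo-rec : ∀ t → geo t ≈ 𝟙 ⊕ q^ (suc t) ⊛ geo t
geo-rec t = begin
  geo t                                    ≈⟨ D-suc _ ⟩
  𝟙 ⊕ q^ 1 ⊛ D (λ i → q^ (t + i * t))        ≈⟨ ⊕-congˡ (⊛-congˡ (D-cong λ i → q^-+ t (i * t))) ⟩
  𝟙 ⊕ q^ 1 ⊛ D (λ i → q^ t ⊛ q^ (i * t))      ≈⟨ ⊕-congˡ (⊛-congˡ (D-⊛ (q^ t) _)) ⟩
  𝟙 ⊕ q^ 1 ⊛ (q^ t ⊛ geo t)                  ≈⟨ ⊕-congˡ (⊛-assoc _ _ _) ⟨
  𝟙 ⊕ q^ 1 ⊛ q^ t ⊛ geo t                    ≈⟨ ⊕-congˡ (⊛-congʳ (q^-+ 1 t)) ⟨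
  𝟙 ⊕ q^ (suc t) ⊛ geo t                    ∎
  where open ≈-Reasoning

geo-⊛-rec : ∀ t f → geo t ⊛ f ≈ f ⊕ q^ (suc t) ⊛ (geo t ⊛ f)
geo-⊛-rec t f = begin
  geo t ⊛ f                          ≈⟨ ⊛-congʳ (geo-rec t) ⟩
  (𝟙 ⊕ q^ (suc t) ⊛ geo t) ⊛ f        ≈⟨ solve 3 (λ a b f → (con 1 :+ a :* b) :* f := f :+ a :* (b :* f))
       ≈-refl (q^ (suc t)) (geo t) f ⟩
  f ⊕ q^ (suc t) ⊛ (geo t ⊛ f)        ∎
  where open ≈-Reasoning

-- The hypothesis is (1 - q^(t+1)) f = g, so this is division by 1 - q^(t+1) without subtraction.
-- Multiplied by `geo t`, it expands `geo t ⊛ f` in a second way besides `geo-⊛-rec`, and the common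
-- summand cancels.
geo-unique : ∀ t {f g} → f ≈ g ⊕ q^ (suc t) ⊛ f → f ≈ geo t ⊛ g
geo-unique t {f} {g} p = ⊕-cancelʳ {h = q^ (suc t) ⊛ (geo t ⊛ f)} (begin
  f ⊕ q^ (suc t) ⊛ (geo t ⊛ f)          ≈⟨ geo-⊛-rec t f ⟨
  geo t ⊛ f                            ≈⟨ ⊛-congˡ p ⟩
  geo t ⊛ (g ⊕ q^ (suc t) ⊛ f)          ≈⟨ solve 4 (λ a b f g → b :* (g :+ a :* f) := b :* g :+ a :* (b :* f))
       ≈-refl (q^ (suc t)) (geo t) f g ⟩
  geo t ⊛ g ⊕ q^ (suc t) ⊛ (geo t ⊛ f)  ∎)
  where open ≈-Reasoning

-- The generating function of the partitions with all parts in (b , b + l].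
ag : ℕ → ℕ → Series
ag b zero    = 𝟙
ag b (suc l) = geo (b + l) ⊛ ag b l

a : ℕ → Series
a = ag 0

ag-suc : ∀ b l → ag b (suc l) ≈ ag b l ⊕ q^ (suc (b + l)) ⊛ ag b (suc l)
ag-suc b l = geo-⊛-rec (b + l) (ag b l)

a-ones : ∀ l → a (suc l) ≈ geo 0 ⊛ ag 1 l
a-ones zero    = ≈-refl
a-ones (suc l) = ≈-trans (⊛-congˡ (a-ones l))
  (solve 3 (λ a b c → a :* (b :* c) := b :* (a :* c)) ≈-refl _ _ _)

-- The predecessor of `a l`, with 0 in place of the missing a (-1). Thus `a-rec` also holds at
-- `l = 0`, where it reads 1 = 0 + 1, and sums can be split without a case distinction.
a⁻ : ℕ → Series
a⁻ zero    = 𝟘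
a⁻ (suc l) = a l

a-rec : ∀ l → a l ≈ a⁻ l ⊕ q^ l ⊛ a l
a-rec zero    = ≈-sym (≈-trans (⊕-identityˡ _) (⊛-identityˡ _))
a-rec (suc l) = ag-suc 0 l

-- The generating function of the partitions with all parts > t; the summand j is that of those
-- with j parts.
G : ℕ → Series
G t = D (λ j → q^ (t * j) ⊛ a j)

D-a⁻ : ∀ (F : ℕ → Series) → D (λ j → F j ⊛ a⁻ j) ≈ q^ 1 ⊛ D (λ j → F (suc j) ⊛ a j)
D-a⁻ F = begin
  D (λ j → F j ⊛ a⁻ j)                           ≈⟨ D-suc _ ⟩
  F 0 ⊛ 𝟘 ⊕ q^ 1 ⊛ D (λ j → F (suc j) ⊛ a j)      ≈⟨ ⊕-congʳ (⊛-zeroʳ (F 0)) ⟩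
  𝟘 ⊕ q^ 1 ⊛ D (λ j → F (suc j) ⊛ a j)            ≈⟨ ⊕-identityˡ _ ⟩
  q^ 1 ⊛ D (λ j → F (suc j) ⊛ a j)                ∎
  where open ≈-Reasoning

-- A partition with all parts > t either has no part t + 1 or loses one. In the sum over the number
-- j of parts this is `a-rec j`: the term with `q^ j` raises every part and gives `G (suc t)`, the
-- other one sums to `q^ (suc t) ⊛ G t`.
G-rec : ∀ t → G t ≈ G (suc t) ⊕ q^ (suc t) ⊛ G t
G-rec t = begin
  G t
    ≈⟨ D-cong (λ j → ⊛-congˡ (a-rec j)) ⟩
  D (λ j → q^ (t * j) ⊛ (a⁻ j ⊕ q^ j ⊛ a j))
    ≈⟨ D-cong split ⟩
  D (λ j → q^ (suc t * j) ⊛ a j ⊕ q^ (t * j) ⊛ a⁻ j)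
    ≈⟨ D-⊕ _ _ ⟩
  G (suc t) ⊕ D (λ j → q^ (t * j) ⊛ a⁻ j)
    ≈⟨ ⊕-congˡ (D-a⁻ λ j → q^ (t * j)) ⟩
  G (suc t) ⊕ q^ 1 ⊛ D (λ j → q^ (t * suc j) ⊛ a j)
    ≈⟨ ⊕-congˡ (⊛-congˡ (D-cong λ j →
         ≈-trans (⊛-congʳ (q^-≡ t (t * j) (*-suc t j))) (⊛-assoc _ _ _))) ⟩
  G (suc t) ⊕ q^ 1 ⊛ D (λ j → q^ t ⊛ (q^ (t * j) ⊛ a j))
    ≈⟨ ⊕-congˡ (⊛-congˡ (D-⊛ (q^ t) _)) ⟩
  G (suc t) ⊕ q^ 1 ⊛ (q^ t ⊛ G t)
    ≈⟨ ⊕-congˡ (≈-sym (≈-trans (⊛-congʳ (q^-+ 1 t)) (⊛-assoc _ _ _))) ⟩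
  G (suc t) ⊕ q^ (suc t) ⊛ G t ∎
  where
  open ≈-Reasoning
  split : ∀ j → q^ (t * j) ⊛ (a⁻ j ⊕ q^ j ⊛ a j) ≈ q^ (suc t * j) ⊛ a j ⊕ q^ (t * j) ⊛ a⁻ j
  split j = ≈-trans
    (solve 4 (λ p q r s → p :* (q :+ r :* s) := (r :* p) :* s :+ p :* q) ≈-refl
      (q^ (t * j)) (a⁻ j) (q^ j) (a j))
    (⊕-congʳ (⊛-congʳ (≈-sym (q^-+ j (t * j)))))

-- A partition is cut into its parts ≤ t and its parts > t. The induction moves one factor at a
-- time, since `G t` is `geo t ⊛ G (suc t)` by `G-rec`.
a-⊛-G : ∀ t → a t ⊛ G t ≈ G 0
a-⊛-G zero    = ⊛-identityˡ (G 0)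
a-⊛-G (suc t) = begin
  geo t ⊛ a t ⊛ G (suc t)     ≈⟨ solve 3 (λ p q r → p :* q :* r := q :* (p :* r)) ≈-refl _ _ _ ⟩
  a t ⊛ (geo t ⊛ G (suc t))   ≈⟨ ⊛-congˡ (geo-unique t (G-rec t)) ⟨
  a t ⊛ G t                   ≈⟨ a-⊛-G t ⟩
  G 0                         ∎
  where open ≈-Reasoning

durfee : ℕ → ℕ → ℕ → Series
durfee d i j = q^ (i * (i + d)) ⊛ (a j ⊛ (a i ⊛ a (i + d)))

-- Induction on `w` for all `d` at once. By `recurrence`, the sum for `suc w` and `d`, multiplied by
-- 1 - q^(w+1), is the sum for `w` and `suc d`; the right-hand sides are related in the same way.
durfee-sum : ∀ w d → ∑ₛ (durfee d) w ≈ a w ⊛ a (w + d)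
durfee-sum zero    d = ≈-trans (∑ₛ-zero _)
  (≈-trans (⊛-identityˡ _) (⊛-identityˡ _))
durfee-sum (suc w) d = begin
  ∑ₛ (durfee d) (suc w)                      ≈⟨ geo-unique w recurrence ⟩
  geo w ⊛ ∑ₛ (durfee (suc d)) w              ≈⟨ ⊛-congˡ (durfee-sum w (suc d)) ⟩
  geo w ⊛ (a w ⊛ a (w + suc d))              ≈⟨ ⊛-assoc _ _ _ ⟨
  a (suc w) ⊛ a (w + suc d)                  ≈⟨ ⊛-congˡ (≈-reflexive (cong a (+-suc w d))) ⟩
  a (suc w) ⊛ a (suc w + d)                  ∎
  where
  open ≈-Reasoning
  α β : ℕ → ℕ → Series
  α i j = q^ (i * (i + d)) ⊛ (a j ⊛ (a⁻ i ⊛ a (i + d)))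
  β i j = q^ (i + i * (i + d)) ⊛ (a⁻ j ⊛ (a i ⊛ a (i + d)))

  -- Expanding `a i` and then `a j` by `a-rec` leaves q^i q^j times the original summand, and q^i
  -- q^j is q^(w+1) on the whole antidiagonal.
  split : ∀ i j → i + j ≡ suc w → durfee d i j ≈ α i j ⊕ β i j ⊕ q^ (suc w) ⊛ durfee d i j
  split i j e = begin
    X ⊛ (a j ⊛ (a i ⊛ A))
      ≈⟨ ⊛-congˡ (⊛-congˡ (⊛-congʳ (a-rec i))) ⟩
    X ⊛ (a j ⊛ ((a⁻ i ⊕ q^ i ⊛ a i) ⊛ A))
      ≈⟨ solve 6 (λ X aj b q c A → X :* (aj :* ((b :+ q :* c) :* A)) := X :* (aj :* (b :* A)) :+ q :* X :* (aj :* (c :* A)))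
           ≈-refl X (a j) (a⁻ i) (q^ i) (a i) A ⟩
    α i j ⊕ q^ i ⊛ X ⊛ (a j ⊛ (a i ⊛ A))
      ≈⟨ ⊕-congˡ (⊛-congˡ (⊛-congʳ (a-rec j))) ⟩
    α i j ⊕ q^ i ⊛ X ⊛ ((a⁻ j ⊕ q^ j ⊛ a j) ⊛ (a i ⊛ A))
      ≈⟨ solve 7 (λ α q X b r c A → α :+ q :* X :* ((b :+ r :* c) :* A) := α :+ (q :* X) :* (b :* A) :+ (q :* r) :* (X :* (c :* A)))
           ≈-refl (α i j) (q^ i) X (a⁻ j) (q^ j) (a j) (a i ⊛ A) ⟩
    α i j ⊕ q^ i ⊛ X ⊛ (a⁻ j ⊛ (a i ⊛ A)) ⊕ q^ i ⊛ q^ j ⊛ durfee d i j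
      ≈⟨ ⊕-cong (⊕-congˡ (⊛-congʳ (≈-sym (q^-+ i _)))) (⊛-congʳ (≈-sym (q^-≡ i j (sym e)))) ⟩
    α i j ⊕ β i j ⊕ q^ (suc w) ⊛ durfee d i j ∎
    where
    X = q^ (i * (i + d))
    A = a (i + d)

  -- After the index shifts, `α` and `β` differ only in the power q^(i+d+1) and in the last factor,
  -- so `a-rec (suc (i + d))` joins them.
  merge : ∀ i j → α (suc i) j ⊕ β i (suc j) ≈ durfee (suc d) i j
  merge i j = begin
    q^ (suc i * (suc i + d)) ⊛ (a j ⊛ (a i ⊛ a (suc (i + d)))) ⊕ β i (suc j)
      ≈⟨ ⊕-congʳ (⊛-congʳ (q^-≡ (suc (i + d)) (i + i * (i + d)) (exponent i d))) ⟩
    q^ (suc (i + d)) ⊛ Y ⊛ (a j ⊛ (a i ⊛ a (suc (i + d)))) ⊕ Y ⊛ (a j ⊛ (a i ⊛ a (i + d)))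
      ≈⟨ solve 6 (λ q Y b c d e → q :* Y :* (b :* (c :* d)) :+ Y :* (b :* (c :* e)) := Y :* (b :* (c :* (e :+ q :* d))))
           ≈-refl (q^ (suc (i + d))) Y (a j) (a i) (a (suc (i + d))) (a (i + d)) ⟩
    Y ⊛ (a j ⊛ (a i ⊛ (a (i + d) ⊕ q^ (suc (i + d)) ⊛ a (suc (i + d)))))
      ≈⟨ ⊛-congˡ (⊛-congˡ (⊛-congˡ (a-rec (suc (i + d))))) ⟨
    Y ⊛ (a j ⊛ (a i ⊛ a (suc (i + d))))
      ≈⟨ ⊛-cong (≈-reflexive (cong q^ (exponent′ i d))) (⊛-congˡ (⊛-congˡ (≈-reflexive (cong a (sym (+-suc i d)))))) ⟩
    durfee (suc d) i j ∎
    where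
    Y = q^ (i + i * (i + d))
    exponent : ∀ i d → suc i * (suc i + d) ≡ suc (i + d) + (i + i * (i + d))
    exponent = solve-∀
    exponent′ : ∀ i d → i + i * (i + d) ≡ i * (i + suc d)
    exponent′ = solve-∀

  -- The boundary terms vanish because `a⁻ 0` is zero. This shortens both antidiagonals from `suc w`
  -- to `w`.
  α₀ : ∀ j → α 0 j ≈ 𝟘
  α₀ j = ≈-trans (⊛-identityˡ _) (≈-trans (⊛-congˡ (⊛-zeroˡ _)) (⊛-zeroʳ _))

  β₀ : ∀ i → β i 0 ≈ 𝟘
  β₀ i = ≈-trans (⊛-congˡ (⊛-zeroˡ _)) (⊛-zeroʳ _)

  recurrence : ∑ₛ (durfee d) (suc w) ≈ ∑ₛ (durfee (suc d)) w ⊕ q^ (suc w) ⊛ ∑ₛ (durfee d) (suc w)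
  recurrence = begin
    ∑ₛ (durfee d) (suc w)
      ≈⟨ ∑ₛ-cong (suc w) split ⟩
    ∑ₛ (λ i j → α i j ⊕ β i j ⊕ q^ (suc w) ⊛ durfee d i j) (suc w)
      ≈⟨ ≈-trans (∑ₛ-⊕ _ _ (suc w)) (⊕-cong (∑ₛ-⊕ α β (suc w)) (∑ₛ-⊛ _ _ (suc w))) ⟩
    ∑ₛ α (suc w) ⊕ ∑ₛ β (suc w) ⊕ q^ (suc w) ⊛ ∑ₛ (durfee d) (suc w)
      ≈⟨ ⊕-congʳ (⊕-cong (≈-trans (∑ₛ-suc α w) (≈-trans (⊕-congʳ (α₀ (suc w))) (⊕-identityˡ _)))
                         (≈-trans (∑ₛ-sucʳ β w) (≈-trans (⊕-congˡ (β₀ (suc w))) (≈-trans (⊕-comm _ _) (⊕-identityˡ _))))) ⟩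
    ∑ₛ (λ i j → α (suc i) j) w ⊕ ∑ₛ (λ i j → β i (suc j)) w ⊕ q^ (suc w) ⊛ ∑ₛ (durfee d) (suc w)
      ≈⟨ ⊕-congʳ (≈-trans (≈-sym (∑ₛ-⊕ _ _ w)) (∑ₛ-cong w λ i j _ → merge i j)) ⟩
    ∑ₛ (durfee (suc d)) w ⊕ q^ (suc w) ⊛ ∑ₛ (durfee d) (suc w) ∎

-- Multiplied by q^d, `Y d` counts the pairs of partitions with largest parts `w` and `w + d`.
-- Multiplied by (1 - q) q^d, `X d` counts the partitions with crank `d`, up to a correction at q^1.
Y X : ℕ → Series
Y d = D (λ w → q^ w ⊛ (a w ⊛ a (w + d)))
X d = D (λ i → q^ (i + i * (i + d)) ⊛ (a i ⊛ a (i + d)))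

-- After `durfee-sum`, the total power q^(2w) factors along `w = i + j`, so the double sum is a
-- product: the terms in `j` make up `G 1`, those in `i` make up `X d`.
Y≈G⊛X : ∀ d → Y d ≈ G 1 ⊛ X d
Y≈G⊛X d = begin
  Y d
    ≈⟨ D-cong (λ w → ⊛-congˡ (≈-sym (durfee-sum w d))) ⟩
  D (λ w → q^ w ⊛ ∑ₛ (durfee d) w)
    ≈⟨ D-cong (λ w → ∑ₛ-⊛ (q^ w) (durfee d) w) ⟨
  D (λ w → ∑ₛ (λ i j → q^ w ⊛ durfee d i j) w)
    ≈⟨ D-cong (λ w → ∑ₛ-cong w (regroup w)) ⟩
  D (∑ₛ λ i j → q^ (i + i * (i + d)) ⊛ (a i ⊛ a (i + d)) ⊛ (q^ (1 * j) ⊛ a j))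
    ≈⟨ D-product _ _ ⟨
  X d ⊛ G 1
    ≈⟨ ⊛-comm _ _ ⟩
  G 1 ⊛ X d ∎
  where
  open ≈-Reasoning
  regroup : ∀ w i j → i + j ≡ w → q^ w ⊛ durfee d i j ≈
            q^ (i + i * (i + d)) ⊛ (a i ⊛ a (i + d)) ⊛ (q^ (1 * j) ⊛ a j)
  regroup w i j e = begin
    q^ w ⊛ durfee d i j
      ≈⟨ ⊛-congʳ (q^-≡ i (1 * j) (trans (sym e) (cong (i +_) (sym (*-identityˡ j))))) ⟩
    q^ i ⊛ q^ (1 * j) ⊛ durfee d i j
      ≈⟨ solve 5 (λ p r q c A → p :* r :* (q :* (c :* A)) := (p :* q) :* A :* (r :* c))
           ≈-refl (q^ i) (q^ (1 * j)) (q^ (i * (i + d))) (a j) (a i ⊛ a (i + d)) ⟩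
    q^ i ⊛ q^ (i * (i + d)) ⊛ (a i ⊛ a (i + d)) ⊛ (q^ (1 * j) ⊛ a j)
      ≈⟨ ⊛-congʳ (⊛-congʳ (q^-+ i _)) ⟨
    q^ (i + i * (i + d)) ⊛ (a i ⊛ a (i + d)) ⊛ (q^ (1 * j) ⊛ a j) ∎

-- Unimodal pairs and the crank

-- The index `N` stands for the maximum `N + 1`, and the two factors `a` for the parts on either
-- side of the peak. In `U₀` the peak is the first maximum and later ones belong to `a (suc N)`. In
-- `U₁` and `U₂` each maximum contributes only `N`, because `u m n` counts compositions of `n + m`.
-- `X₊` is the sum of q^e `X e` over e ≥ 1.
U₀ U₁ U₂ X₊ : Series
U₀ = D (λ N → q^ 1 ⊛ (a N ⊛ a (suc N)))
U₁ = D (λ N → a N ⊛ a N)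
U₂ = D (λ N → q^ N ⊛ (a N ⊛ a N))
X₊ = D (λ d → q^ 1 ⊛ X (suc d))

-- The partitions with parts at most `N` are sorted by their largest part `w`; `d` is the gap
-- between `w` and `N`.
a-sum : ∀ N → ∑ₛ (λ d w → q^ w ⊛ a w) N ≈ a N
a-sum zero    = ≈-trans (∑ₛ-zero _) (⊛-identityˡ _)
a-sum (suc N) = begin
  ∑ₛ (λ d w → q^ w ⊛ a w) (suc N)                         ≈⟨ ∑ₛ-suc _ N ⟩
  q^ (suc N) ⊛ a (suc N) ⊕ ∑ₛ (λ d w → q^ w ⊛ a w) N       ≈⟨ ⊕-congˡ (a-sum N) ⟩
  q^ (suc N) ⊛ a (suc N) ⊕ a N                            ≈⟨ ⊕-comm _ _ ⟩
  a N ⊕ q^ (suc N) ⊛ a (suc N)                            ≈⟨ a-rec (suc N) ⟨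
  a (suc N)                                              ∎
  where open ≈-Reasoning

-- By `a-sum`, the partition counted by `a N` gets a largest part `w`; the other partition has
-- largest part `N + 1`, that is, `w + suc d`. Summing over `w` first gives q^(d+1) `Y (suc d)`.
U₀≈G⊛X₊ : U₀ ≈ G 1 ⊛ X₊
U₀≈G⊛X₊ = begin
  U₀
    ≈⟨ D-cong expand ⟩
  D (∑ₛ λ d w → q^ 1 ⊛ (q^ w ⊛ (a w ⊛ a (w + suc d))))
    ≈⟨ D-assoc _ ⟩
  D (λ d → D (λ w → q^ 1 ⊛ (q^ w ⊛ (a w ⊛ a (w + suc d)))))
    ≈⟨ D-cong (λ d → D-⊛ (q^ 1) _) ⟩
  D (λ d → q^ 1 ⊛ Y (suc d))
    ≈⟨ D-cong (λ d → ≈-trans (⊛-congˡ (Y≈G⊛X (suc d)))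
         (solve 3 (λ p q r → p :* (q :* r) := q :* (p :* r)) ≈-refl (q^ 1) (G 1) (X (suc d)))) ⟩
  D (λ d → G 1 ⊛ (q^ 1 ⊛ X (suc d)))
    ≈⟨ D-⊛ (G 1) _ ⟩
  G 1 ⊛ X₊ ∎
  where
  open ≈-Reasoning
  expand : ∀ N → q^ 1 ⊛ (a N ⊛ a (suc N)) ≈
           ∑ₛ (λ d w → q^ 1 ⊛ (q^ w ⊛ (a w ⊛ a (w + suc d)))) N
  expand N = begin
    q^ 1 ⊛ (a N ⊛ a (suc N))
      ≈⟨ solve 3 (λ p q r → p :* (q :* r) := (p :* r) :* q) ≈-refl (q^ 1) (a N) (a (suc N)) ⟩
    q^ 1 ⊛ a (suc N) ⊛ a N
      ≈⟨ ⊛-congˡ (a-sum N) ⟨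
    q^ 1 ⊛ a (suc N) ⊛ ∑ₛ (λ d w → q^ w ⊛ a w) N
      ≈⟨ ∑ₛ-⊛ _ _ N ⟨
    ∑ₛ (λ d w → q^ 1 ⊛ a (suc N) ⊛ (q^ w ⊛ a w)) N
      ≈⟨ ∑ₛ-cong N (λ d w e → ≈-trans
           (⊛-congʳ (⊛-congˡ (≈-reflexive (cong a (trans (cong suc (trans (sym e) (+-comm d w))) (sym (+-suc w d)))))))
           (solve 4 (λ p q r s → p :* q :* (r :* s) := p :* (r :* (s :* q))) ≈-refl
              (q^ 1) (a (w + suc d)) (q^ w) (a w))) ⟩
    ∑ₛ (λ d w → q^ 1 ⊛ (q^ w ⊛ (a w ⊛ a (w + suc d)))) N ∎

-- For pairs of partitions with largest parts m and w, the case m ≥ w is split into m > w and m = w: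
-- `a-rec N` separates the partitions that have largest part `N`.
U₁≈U₀⊕U₂ : U₁ ≈ U₀ ⊕ U₂
U₁≈U₀⊕U₂ = begin
  U₁
    ≈⟨ D-cong (λ N → ≈-trans (⊛-congʳ (a-rec N))
         (solve 3 (λ p q r → (p :+ q :* r) :* r := r :* p :+ q :* (r :* r))
              ≈-refl (a⁻ N) (q^ N) (a N))) ⟩
  D (λ N → a N ⊛ a⁻ N ⊕ q^ N ⊛ (a N ⊛ a N))
    ≈⟨ D-⊕ _ _ ⟩
  D (λ N → a N ⊛ a⁻ N) ⊕ U₂
    ≈⟨ ⊕-congʳ (D-a⁻ a) ⟩
  q^ 1 ⊛ D (λ N → a (suc N) ⊛ a N) ⊕ U₂
    ≈⟨ ⊕-congʳ (D-⊛ (q^ 1) _) ⟨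
  D (λ N → q^ 1 ⊛ (a (suc N) ⊛ a N)) ⊕ U₂
    ≈⟨ ⊕-congʳ (D-cong λ N → ⊛-congˡ (⊛-comm _ _)) ⟩
  U₀ ⊕ U₂ ∎
  where open ≈-Reasoning

-- q^e K e is the generating function of the partitions with crank e and at least one 1; the index w
-- stands for ω = w + 1.
K : ℕ → Series
K e = D (λ w → q^ (1 + (suc w + suc w * (suc w + e))) ⊛ (ag 1 w ⊛ a (suc w + e)))

-- `K₊` is the sum of q^e `K e` over e ≥ 1. In `noOnes` there are m + 1 parts, each at least 2, so
-- the crank is the largest part and positive. The `𝟙` in `crankZero` is the empty partition.
K₊ noOnes crankPositive crankZero : Series
K₊ = D (λ d → q^ 1 ⊛ K (suc d))
noOnes = D (λ m → q^ (2 + m) ⊛ a (suc m))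
crankPositive = noOnes ⊕ K₊
crankZero = 𝟙 ⊕ K 0

private
  -- The terms of `X e` with i ≥ 1, where `w` is i - 1. Multiplication by 1 - q removes the ones
  -- from `a (suc w)` and so turns `B e` into `K e`. The term `a e` at i = 0 is treated apart.
  B : ℕ → Series
  B e = D (λ w → q^ (1 + (suc w + suc w * (suc w + e))) ⊛ (a (suc w) ⊛ a (suc w + e)))

  X≈a⊕B : ∀ e → X e ≈ a e ⊕ B e
  X≈a⊕B e = ≈-trans (D-suc _) (⊕-cong
    (≈-trans (⊛-identityˡ _) (⊛-identityˡ _))
    (≈-trans (≈-sym (D-⊛ (q^ 1) _)) (D-cong λ w →
      ≈-trans (≈-sym (⊛-assoc _ _ _)) (⊛-congʳ (≈-sym (q^-+ 1 (suc w + suc w * (suc w + e))))))))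

  a-suc-ones : ∀ l → a (suc l) ≈ ag 1 l ⊕ q^ 1 ⊛ a (suc l)
  a-suc-ones l = begin
    a (suc l)                             ≈⟨ a-ones l ⟩
    geo 0 ⊛ ag 1 l                        ≈⟨ geo-⊛-rec 0 (ag 1 l) ⟩
    ag 1 l ⊕ q^ 1 ⊛ (geo 0 ⊛ ag 1 l)       ≈⟨ ⊕-congˡ (⊛-congˡ (a-ones l)) ⟨
    ag 1 l ⊕ q^ 1 ⊛ a (suc l)              ∎
    where open ≈-Reasoning

  B-rec : ∀ e → B e ≈ K e ⊕ q^ 1 ⊛ B e
  B-rec e = begin
    B e
      ≈⟨ D-cong (λ w → ≈-trans (⊛-congˡ (⊛-congʳ (a-suc-ones w)))
           (solve 5 (λ p q r s t → p :* ((q :+ r :* s) :* t) := p :* (q :* t) :+ r :* (p :* (s :* t))) ≈-refl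
             (q^ (1 + (suc w + suc w * (suc w + e)))) (ag 1 w) (q^ 1) (a (suc w)) (a (suc w + e)))) ⟩
    D (λ w → q^ (1 + (suc w + suc w * (suc w + e))) ⊛ (ag 1 w ⊛ a (suc w + e))
             ⊕ q^ 1 ⊛ (q^ (1 + (suc w + suc w * (suc w + e))) ⊛ (a (suc w) ⊛ a (suc w + e))))
      ≈⟨ ≈-trans (D-⊕ _ _) (⊕-congˡ (D-⊛ (q^ 1) _)) ⟩
    K e ⊕ q^ 1 ⊛ B e ∎
    where open ≈-Reasoning

  A B₊ : Series
  A = D (λ d → q^ 1 ⊛ a (suc d))
  B₊ = D (λ d → q^ 1 ⊛ B (suc d))

  -- Since q^e `a e` counts the partitions with e parts, `A` counts the nonempty ones. A partition
  -- containing 1 loses one such part and may become empty, which accounts for the `𝟙`.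
  A-rec : A ≈ q^ 1 ⊛ (𝟙 ⊕ A) ⊕ noOnes
  A-rec = begin
    A
      ≈⟨ D-cong (λ d → ≈-trans (⊛-congˡ (a-rec (suc d)))
           (solve 4 (λ p q r s → p :* (q :+ r :* s) := p :* q :+ (p :* r) :* s)
                ≈-refl (q^ 1) (a d) (q^ (suc d)) (a (suc d)))) ⟩
    D (λ d → q^ 1 ⊛ a d ⊕ q^ 1 ⊛ q^ (suc d) ⊛ a (suc d))
      ≈⟨ ≈-trans (D-⊕ _ _) (⊕-cong (D-⊛ (q^ 1) a) (D-cong λ d → ⊛-congʳ (≈-sym (q^-+ 1 (suc d))))) ⟩
    q^ 1 ⊛ D a ⊕ noOnes
      ≈⟨ ⊕-congʳ (⊛-congˡ (≈-trans (D-suc a) (⊕-congˡ (≈-sym (D-⊛ (q^ 1) _))))) ⟩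
    q^ 1 ⊛ (𝟙 ⊕ A) ⊕ noOnes ∎
    where open ≈-Reasoning

  B₊-rec : B₊ ≈ K₊ ⊕ q^ 1 ⊛ B₊
  B₊-rec = begin
    B₊
      ≈⟨ D-cong (λ d → ≈-trans (⊛-congˡ (B-rec (suc d))) (⊛-distribˡ _ _ _)) ⟩
    D (λ d → q^ 1 ⊛ K (suc d) ⊕ q^ 1 ⊛ (q^ 1 ⊛ B (suc d)))
      ≈⟨ ≈-trans (D-⊕ _ _) (⊕-congˡ (D-⊛ (q^ 1) _)) ⟩
    K₊ ⊕ q^ 1 ⊛ B₊ ∎
    where open ≈-Reasoning

  X₊≈A⊕B₊ : X₊ ≈ A ⊕ B₊
  X₊≈A⊕B₊ = ≈-trans (D-cong λ d → ≈-trans (⊛-congˡ (X≈a⊕B (suc d))) (⊛-distribˡ _ _ _)) (D-⊕ _ _)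

-- In other words, (1 - q) `X₊` is `crankPositive` plus q. The extra q is the conventional value 1
-- of `C fzero` at 1: the partition of 1 has crank -1 and is missing from `crankPositive`.
X₊-rec : X₊ ≈ crankPositive ⊕ q^ 1 ⊕ q^ 1 ⊛ X₊
X₊-rec = begin
  X₊
    ≈⟨ X₊≈A⊕B₊ ⟩
  A ⊕ B₊
    ≈⟨ ⊕-cong A-rec B₊-rec ⟩
  q^ 1 ⊛ (𝟙 ⊕ A) ⊕ noOnes ⊕ (K₊ ⊕ q^ 1 ⊛ B₊)
    ≈⟨ solve 5 (λ q A N K B → q :* (con 1 :+ A) :+ N :+ (K :+ q :* B) := N :+ K :+ q :+ q :* (A :+ B))
         ≈-refl (q^ 1) A noOnes K₊ B₊ ⟩
  crankPositive ⊕ q^ 1 ⊕ q^ 1 ⊛ (A ⊕ B₊)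
    ≈⟨ ⊕-congˡ (⊛-congˡ X₊≈A⊕B₊) ⟨
  crankPositive ⊕ q^ 1 ⊕ q^ 1 ⊛ X₊ ∎
  where open ≈-Reasoning

-- In other words, (1 - q) `X 0` is `crankZero` minus q, and -q is the conventional value -1 at 1.
X₀-rec : X 0 ⊕ q^ 1 ≈ crankZero ⊕ q^ 1 ⊛ X 0
X₀-rec = begin
  X 0 ⊕ q^ 1
    ≈⟨ ⊕-congʳ (≈-trans (X≈a⊕B 0) (⊕-congˡ (B-rec 0))) ⟩
  𝟙 ⊕ (K 0 ⊕ q^ 1 ⊛ B 0) ⊕ q^ 1
    ≈⟨ solve 3 (λ q K B → con 1 :+ (K :+ q :* B) :+ q := con 1 :+ K :+ q :* (con 1 :+ B))
         ≈-refl (q^ 1) (K 0) (B 0) ⟩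
  crankZero ⊕ q^ 1 ⊛ (𝟙 ⊕ B 0)
    ≈⟨ ⊕-congˡ (⊛-congˡ (X≈a⊕B 0)) ⟨
  crankZero ⊕ q^ 1 ⊛ X 0 ∎
  where open ≈-Reasoning

U₂≈G⊛X : U₂ ≈ G 1 ⊛ X 0
U₂≈G⊛X = ≈-trans (D-cong λ N → ⊛-congˡ (⊛-congˡ (≈-reflexive (cong a (sym (+-identityʳ N)))))) (Y≈G⊛X 0)

-- `G 1` is (1 - q) `G 0`, so the factor 1 - q of `X₊-rec` can be moved over to `G 0`, which leaves
-- `G 1 ⊛ X₊`. Adding q `G 0` `X₊` to both sides avoids the subtraction.
crankPositive-⊛-G : G 0 ⊛ (crankPositive ⊕ q^ 1) ≈ U₀
crankPositive-⊛-G = ⊕-cancelʳ {h = q^ 1 ⊛ (G 0 ⊛ X₊)} (begin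
  G 0 ⊛ (crankPositive ⊕ q^ 1) ⊕ q^ 1 ⊛ (G 0 ⊛ X₊)
    ≈⟨ solve 4 (λ g c q X → g :* c :+ q :* (g :* X) := g :* (c :+ q :* X))
         ≈-refl (G 0) (crankPositive ⊕ q^ 1) (q^ 1) X₊ ⟩
  G 0 ⊛ (crankPositive ⊕ q^ 1 ⊕ q^ 1 ⊛ X₊)
    ≈⟨ ⊛-congˡ X₊-rec ⟨
  G 0 ⊛ X₊
    ≈⟨ ⊛-congʳ (G-rec 0) ⟩
  (G 1 ⊕ q^ 1 ⊛ G 0) ⊛ X₊
    ≈⟨ solve 4 (λ g q h X → (g :+ q :* h) :* X := g :* X :+ q :* (h :* X)) ≈-refl (G 1) (q^ 1) (G 0) X₊ ⟩
  G 1 ⊛ X₊ ⊕ q^ 1 ⊛ (G 0 ⊛ X₊)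
    ≈⟨ ⊕-congʳ U₀≈G⊛X₊ ⟨
  U₀ ⊕ q^ 1 ⊛ (G 0 ⊛ X₊) ∎)
  where open ≈-Reasoning

crankZero-⊛-G : G 0 ⊛ crankZero ≈ U₂ ⊕ G 0 ⊛ q^ 1
crankZero-⊛-G = ⊕-cancelʳ {h = q^ 1 ⊛ (G 0 ⊛ X 0)} (begin
  G 0 ⊛ crankZero ⊕ q^ 1 ⊛ (G 0 ⊛ X 0)
    ≈⟨ solve 4 (λ g c q X → g :* c :+ q :* (g :* X) := g :* (c :+ q :* X))
         ≈-refl (G 0) crankZero (q^ 1) (X 0) ⟩
  G 0 ⊛ (crankZero ⊕ q^ 1 ⊛ X 0)
    ≈⟨ ⊛-congˡ X₀-rec ⟨
  G 0 ⊛ (X 0 ⊕ q^ 1)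
    ≈⟨ ⊛-distribˡ _ _ _ ⟩
  G 0 ⊛ X 0 ⊕ G 0 ⊛ q^ 1
    ≈⟨ ⊕-congʳ (⊛-congʳ (G-rec 0)) ⟩
  (G 1 ⊕ q^ 1 ⊛ G 0) ⊛ X 0 ⊕ G 0 ⊛ q^ 1
    ≈⟨ solve 4 (λ g q h X → (g :+ q :* h) :* X :+ h :* q := g :* X :+ h :* q :+ q :* (h :* X))
         ≈-refl (G 1) (q^ 1) (G 0) (X 0) ⟩
  G 1 ⊛ X 0 ⊕ G 0 ⊛ q^ 1 ⊕ q^ 1 ⊛ (G 0 ⊛ X 0)
    ≈⟨ ⊕-congʳ (⊕-congʳ U₂≈G⊛X) ⟨
  U₂ ⊕ G 0 ⊛ q^ 1 ⊕ q^ 1 ⊛ (G 0 ⊛ X 0) ∎)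
  where open ≈-Reasoning

-- The corrections q and -q of the two identities above cancel, in accordance with the conventional
-- value 0 at 1.
crankNonneg-⊛-G : G 0 ⊛ (crankPositive ⊕ crankZero) ≈ U₁
crankNonneg-⊛-G = ⊕-cancelʳ {h = G 0 ⊛ q^ 1} (begin
  G 0 ⊛ (crankPositive ⊕ crankZero) ⊕ G 0 ⊛ q^ 1
    ≈⟨ solve 4 (λ g c d q → g :* (c :+ d) :+ g :* q := g :* (c :+ q) :+ g :* d)
         ≈-refl (G 0) crankPositive crankZero (q^ 1) ⟩
  G 0 ⊛ (crankPositive ⊕ q^ 1) ⊕ G 0 ⊛ crankZero
    ≈⟨ ⊕-cong crankPositive-⊛-G crankZero-⊛-G ⟩
  U₀ ⊕ (U₂ ⊕ G 0 ⊛ q^ 1)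
    ≈⟨ solve 3 (λ p q r → p :+ (q :+ r) := p :+ q :+ r) ≈-refl U₀ U₂ (G 0 ⊛ q^ 1) ⟩
  U₀ ⊕ U₂ ⊕ G 0 ⊛ q^ 1
    ≈⟨ ⊕-congʳ U₁≈U₀⊕U₂ ⟨
  U₁ ⊕ G 0 ⊛ q^ 1 ∎)
  where open ≈-Reasoning

-- The truncated pentagonal number theorem

-- The q-binomial coefficient: partitions with at most j parts, all of them ≤ l.
box : ℕ → ℕ → Series
box zero    j       = 𝟙
box (suc l) zero    = box l zero
box (suc l) (suc j) = box l (suc j) ⊕ q^ (suc l) ⊛ box (suc l) j

box-0 : ∀ l → box l 0 ≈ 𝟙
box-0 zero    = ≈-refl
box-0 (suc l) = box-0 l

-- With N + 1 = (l + 1) + (j + 1), both sides solve f = S + q^(N+1) f. On the left, the Pascal rule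
-- defining `box` leads to two smaller cases; on the right, `a-rec` is applied to one factor after
-- the other.
a-⊛-box : ∀ l j → a (l + j) ⊛ box l j ≈ a l ⊛ a j
a-⊛-box zero    j       = ⊛-comm _ _
a-⊛-box (suc l) zero    = ⊛-cong (≈-reflexive (cong a (+-identityʳ (suc l)))) (box-0 l)
a-⊛-box (suc l) (suc j) = ≈-trans (geo-unique (l + suc j) left) (≈-sym (geo-unique (l + suc j) right))
  where
  open ≈-Reasoning
  N = l + suc j
  F = a (suc N) ⊛ box (suc l) (suc j)
  R = a (suc l) ⊛ a (suc j)
  S = a l ⊛ a (suc j) ⊕ q^ (suc l) ⊛ (a (suc l) ⊛ a j)

  left : F ≈ S ⊕ q^ (suc N) ⊛ F
  left = begin
    F
      ≈⟨ ⊛-congʳ (a-rec (suc N)) ⟩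
    (a N ⊕ q^ (suc N) ⊛ a (suc N)) ⊛ box (suc l) (suc j)
      ≈⟨ solve 6 (λ p q r s u v → (p :+ q :* r) :* (s :+ u :* v) := p :* s :+ u :* (p :* v) :+ q :* (r :* (s :+ u :* v))) ≈-refl
           (a N) (q^ (suc N)) (a (suc N)) (box l (suc j)) (q^ (suc l)) (box (suc l) j) ⟩
    a N ⊛ box l (suc j) ⊕ q^ (suc l) ⊛ (a N ⊛ box (suc l) j) ⊕ q^ (suc N) ⊛ F
      ≈⟨ ⊕-congʳ (⊕-cong (a-⊛-box l (suc j)) (⊛-congˡ
           (≈-trans (⊛-congʳ (≈-reflexive (cong a (+-suc l j)))) (a-⊛-box (suc l) j)))) ⟩
    S ⊕ q^ (suc N) ⊛ F ∎

  right : R ≈ S ⊕ q^ (suc N) ⊛ R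
  right = begin
    a (suc l) ⊛ a (suc j)
      ≈⟨ ⊛-congʳ (a-rec (suc l)) ⟩
    (a l ⊕ q^ (suc l) ⊛ a (suc l)) ⊛ a (suc j)
      ≈⟨ solve 4 (λ p q r s → (p :+ q :* r) :* s := p :* s :+ q :* (r :* s))
           ≈-refl (a l) (q^ (suc l)) (a (suc l)) (a (suc j)) ⟩
    a l ⊛ a (suc j) ⊕ q^ (suc l) ⊛ (a (suc l) ⊛ a (suc j))
      ≈⟨ ⊕-congˡ (⊛-congˡ (⊛-congˡ (a-rec (suc j)))) ⟩
    a l ⊛ a (suc j) ⊕ q^ (suc l) ⊛ (a (suc l) ⊛ (a j ⊕ q^ (suc j) ⊛ a (suc j)))
      ≈⟨ solve 6 (λ c q r s u v → c :+ q :* (r :* (s :+ u :* v)) := c :+ q :* (r :* s) :+ (q :* u) :* (r :* v)) ≈-refl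
           (a l ⊛ a (suc j)) (q^ (suc l)) (a (suc l)) (a j) (q^ (suc j)) (a (suc j)) ⟩
    S ⊕ q^ (suc l) ⊛ q^ (suc j) ⊛ R
      ≈⟨ ⊕-congˡ (⊛-congʳ (q^-+ (suc l) (suc j))) ⟨
    S ⊕ q^ (suc N) ⊛ R ∎

-- The difference of `z` and `e` does not depend on `t`, and both vanish from `n` on. The argument
-- `N` of `go` bounds the number of steps still to be made before `n` is reached.
telescope : ∀ {n} (z e : ℕ → ℕ) → (∀ t → z t + e (suc t) ≡ e t + z (suc t)) →
            (∀ t → n ≤ t → z t ≡ 0) → (∀ t → n ≤ t → e t ≡ 0) → ∀ t → z t ≡ e t
telescope {n} z e step z₀ e₀ t = go n t (m≤n+m n t)
  where
  go : ∀ N t → n ≤ t + N → z t ≡ e t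
  go zero    t n≤ = trans (z₀ t n≤t) (sym (e₀ t n≤t))
    where n≤t = subst (n ≤_) (+-identityʳ t) n≤
  go (suc N) t n≤ = +-cancelʳ-≡ (e (suc t)) _ _ (trans (step t)
    (cong (e t +_) (go N (suc t) (subst (n ≤_) (+-suc t N) n≤))))

D-low : ∀ {n} F → (∀ i j → j ≤ n → coeff (F i) j ≡ 0) → coeff (D F) n ≡ 0
D-low {n} F p = trans
  (∑-cong n λ i j e → p i j (subst (j ≤_) e (m≤n+m j i))) (∑-zero n)

module _ (l : ℕ) where
  private
    k = suc l

  -- Up to a power of q, L k and Q k are the series of M k and P̃ k. As functions of t, both L + Q and
  -- Z satisfy f t = m t + p t + f (t + 1) and have order > t, hence they agree.
  L Q Z : ℕ → Series
  L t = D (λ j → q^ (k + t * (k + j)) ⊛ (a (k + j) ⊛ box l j))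
  Q t = D (λ r → q^ (k + (suc t * suc k + r * k)) ⊛ (a k ⊛ G (t + r)))
  Z t = q^ (suc t * k) ⊛ (a k ⊛ G t)

  private
    open ≈-Reasoning

    m p : ℕ → Series
    m t = q^ (suc t * k) ⊛ (a l ⊛ G t)
    p t = q^ (k + suc t * suc k) ⊛ (a k ⊛ G t)

    -- By `a-rec (k + j)` the summand is split in two. The term with `a (l + j) ⊛ box l j` becomes
    -- `a l ⊛ a j` by `a-⊛-box`, and its sum over `j` produces `G t`; the other term has the
    -- exponent belonging to `suc t`.
    L-rec : ∀ t → L t ≈ m t ⊕ L (suc t)
    L-rec t = begin
      L t
        ≈⟨ D-cong split ⟩
      D (λ j → q^ (suc t * k) ⊛ a l ⊛ (q^ (t * j) ⊛ a j) ⊕ q^ (k + suc t * (k + j)) ⊛ (a (k + j) ⊛ box l j))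
        ≈⟨ ≈-trans (D-⊕ _ _) (⊕-congʳ (≈-trans (D-⊛ _ _) (⊛-assoc _ _ _))) ⟩
      m t ⊕ L (suc t) ∎
      where
      e₁ : ∀ l t j → suc l + t * (suc l + j) ≡ suc t * suc l + t * j
      e₁ = solve-∀
      e₂ : ∀ l t j → suc l + suc t * (suc l + j) ≡ suc l + t * (suc l + j) + (suc l + j)
      e₂ = solve-∀
      split : ∀ j → q^ (k + t * (k + j)) ⊛ (a (k + j) ⊛ box l j) ≈
        q^ (suc t * k) ⊛ a l ⊛ (q^ (t * j) ⊛ a j) ⊕ q^ (k + suc t * (k + j)) ⊛ (a (k + j) ⊛ box l j)
      split j = begin
        E ⊛ (a (k + j) ⊛ box l j)
          ≈⟨ ⊛-congˡ (⊛-congʳ (a-rec (k + j))) ⟩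
        E ⊛ ((a (l + j) ⊕ q^ (k + j) ⊛ a (k + j)) ⊛ box l j)
          ≈⟨ solve 5 (λ E p q r b → E :* ((p :+ q :* r) :* b) := E :* (p :* b) :+ (E :* q) :* (r :* b))
               ≈-refl E (a (l + j)) (q^ (k + j)) (a (k + j)) (box l j) ⟩
        E ⊛ (a (l + j) ⊛ box l j) ⊕ E ⊛ q^ (k + j) ⊛ (a (k + j) ⊛ box l j)
          ≈⟨ ⊕-cong (⊛-cong (q^-≡ (suc t * k) (t * j) (e₁ l t j)) (a-⊛-box l j))
                    (⊛-congʳ (≈-sym (q^-≡ (k + t * (k + j)) (k + j) (e₂ l t j)))) ⟩
        q^ (suc t * k) ⊛ q^ (t * j) ⊛ (a l ⊛ a j) ⊕ q^ (k + suc t * (k + j)) ⊛ (a (k + j) ⊛ box l j)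
          ≈⟨ ⊕-congʳ (solve 4 (λ p q r s → p :* q :* (r :* s) := p :* r :* (q :* s))
               ≈-refl (q^ (suc t * k)) (q^ (t * j)) (a l) (a j)) ⟩
        q^ (suc t * k) ⊛ a l ⊛ (q^ (t * j) ⊛ a j) ⊕ q^ (k + suc t * (k + j)) ⊛ (a (k + j) ⊛ box l j) ∎
        where E = q^ (k + t * (k + j))

    -- Together with the q^r supplied by `D`, the summand `r` of `Q t` is `p (t + r)`, so it is
    -- enough to split off the first one.
    Q-rec : ∀ t → Q t ≈ p t ⊕ Q (suc t)
    Q-rec t = ≈-trans (D-suc _) (⊕-cong
      (⊛-cong (≈-reflexive (cong q^ (e₁ l t))) (⊛-congˡ (≈-reflexive (cong G (+-identityʳ t)))))
      (≈-trans (≈-sym (D-⊛ (q^ 1) _)) (D-cong λ r → ≈-trans (≈-sym (⊛-assoc _ _ _))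
        (⊛-cong (≈-sym (q^-≡ 1 _ (e₂ l t r))) (⊛-congˡ (≈-reflexive (cong G (+-suc t r))))))))
      where
      e₁ : ∀ l t → suc l + (suc t * suc (suc l) + 0) ≡ suc l + suc t * suc (suc l)
      e₁ = solve-∀
      e₂ : ∀ l t r → suc l + (suc (suc t) * suc (suc l) + r * suc l) ≡
                     1 + (suc l + (suc t * suc (suc l) + suc r * suc l))
      e₂ = solve-∀

    -- First `a-rec k` splits off `m t`; then `G-rec t` separates `p t` from a remainder with the
    -- exponent of `Z (suc t)`.
    Z-rec : ∀ t → Z t ≈ m t ⊕ p t ⊕ Z (suc t)
    Z-rec t = begin
      E ⊛ (a k ⊛ G t)
        ≈⟨ ⊛-congˡ (⊛-congʳ (a-rec k)) ⟩
      E ⊛ ((a l ⊕ q^ k ⊛ a k) ⊛ G t)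
        ≈⟨ solve 5 (λ E p q r g → E :* ((p :+ q :* r) :* g) := E :* (p :* g) :+ (q :* E) :* (r :* g))
             ≈-refl E (a l) (q^ k) (a k) (G t) ⟩
      m t ⊕ q^ k ⊛ E ⊛ (a k ⊛ G t)
        ≈⟨ ⊕-congˡ (⊛-congˡ (⊛-congˡ (G-rec t))) ⟩
      m t ⊕ q^ k ⊛ E ⊛ (a k ⊛ (G (suc t) ⊕ q^ (suc t) ⊛ G t))
        ≈⟨ solve 6 (λ m q r g s h → m :+ q :* (r :* (g :+ s :* h)) := m :+ (q :* s) :* (r :* h) :+ q :* (r :* g)) ≈-refl
             (m t) (q^ k ⊛ E) (a k) (G (suc t)) (q^ (suc t)) (G t) ⟩
      m t ⊕ q^ k ⊛ E ⊛ q^ (suc t) ⊛ (a k ⊛ G t) ⊕ q^ k ⊛ E ⊛ (a k ⊛ G (suc t))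
        ≈⟨ ⊕-cong (⊕-congˡ (⊛-congʳ (≈-sym (q^-≡₃ k (suc t * k) (suc t) (e l t))))) (⊛-congʳ (≈-sym (q^-+ k (suc t * k)))) ⟩
      m t ⊕ p t ⊕ Z (suc t) ∎
      where
      E = q^ (suc t * k)
      e : ∀ l t → suc l + suc t * suc (suc l) ≡ suc l + suc t * suc l + suc t
      e = solve-∀

    step : ∀ t → Z t ⊕ (L (suc t) ⊕ Q (suc t)) ≈ L t ⊕ Q t ⊕ Z (suc t)
    step t = begin
      Z t ⊕ (L (suc t) ⊕ Q (suc t))
        ≈⟨ ⊕-congʳ (Z-rec t) ⟩
      m t ⊕ p t ⊕ Z (suc t) ⊕ (L (suc t) ⊕ Q (suc t))
        ≈⟨ solve 5 (λ m p Z L Q → m :+ p :+ Z :+ (L :+ Q) := m :+ L :+ (p :+ Q) :+ Z)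
             ≈-refl (m t) (p t) (Z (suc t)) (L (suc t)) (Q (suc t)) ⟩
      m t ⊕ L (suc t) ⊕ (p t ⊕ Q (suc t)) ⊕ Z (suc t)
        ≈⟨ ⊕-congʳ (⊕-cong (L-rec t) (Q-rec t)) ⟨
      L t ⊕ Q t ⊕ Z (suc t) ∎

    L-low : ∀ {n} t → n ≤ t → coeff (L t) n ≡ 0
    L-low t n≤t = D-low (λ j → q^ (k + t * (k + j)) ⊛ (a (k + j) ⊛ box l j)) λ i j j≤n → q^-low (k + t * (k + i)) (a (k + i) ⊛ box l i)
      (≤-trans (s≤s (≤-trans j≤n n≤t)) (+-mono-≤ (s≤s z≤n) (m≤m*n t (k + i))))

    Q-low : ∀ {n} t → n ≤ t → coeff (Q t) n ≡ 0
    Q-low t n≤t = D-low (λ r → q^ (k + (suc t * suc k + r * k)) ⊛ (a k ⊛ G (t + r))) λ i j j≤n → q^-low (k + (suc t * suc k + i * k)) (a k ⊛ G (t + i))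
      (≤-trans (s≤s (≤-trans j≤n n≤t)) (≤-trans (m≤m*n (suc t) (suc k))
        (≤-trans (m≤m+n (suc t * suc k) (i * k)) (m≤n+m _ k))))

  L⊕Q≈Z : ∀ t → L t ⊕ Q t ≈ Z t
  L⊕Q≈Z t = pointwise λ n → sym (telescope {n} (λ t → coeff (Z t) n) (λ t → coeff (L t ⊕ Q t) n)
    (λ t → at (step t) n)
    (λ t n≤t → q^-low (suc t * k) (a k ⊛ G t) (≤-trans (s≤s n≤t) (m≤m*n (suc t) k)))
    (λ t n≤t → cong₂ _+_ (L-low {n} t n≤t) (Q-low {n} t n≤t)) t)

  -- At t = k the product `a k ⊛ G k` is all of `G 0`. The exponent `s` will be k(k-1)/2, the size
  -- of one copy each of 1, ..., k - 1.
  truncated-pentagonal : ∀ s → q^ s ⊛ L k ⊕ q^ s ⊛ Q k ≈ q^ (s + suc k * k) ⊛ G 0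
  truncated-pentagonal s = begin
    q^ s ⊛ L k ⊕ q^ s ⊛ Q k              ≈⟨ ⊛-distribˡ _ _ _ ⟨
    q^ s ⊛ (L k ⊕ Q k)                  ≈⟨ ⊛-congˡ (L⊕Q≈Z k) ⟩
    q^ s ⊛ (q^ (suc k * k) ⊛ (a k ⊛ G k)) ≈⟨ ⊛-assoc _ _ _ ⟨
    q^ s ⊛ q^ (suc k * k) ⊛ (a k ⊛ G k)  ≈⟨ ⊛-cong (≈-sym (q^-+ s _)) (a-⊛-G k) ⟩
    q^ (s + suc k * k) ⊛ G 0            ∎

-- Counting by size

infixr 9 _∘↔_
_∘↔_ : {A B C : Set} → B ↔ C → A ↔ B → A ↔ C
f ∘↔ g = ↔-trans g f

Fiber : {A : Set} → (A → ℕ) → ℕ → Set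
Fiber size n = ∃ λ a → size a ≡ n

infix 4 _Counts_

-- The series is the generating function of the objects by size. Stated with bijections, sums and
-- products of series come from disjoint unions and products of types.
record _Counts_ {A : Set} (size : A → ℕ) (f : Series) : Set where
  constructor counting
  field fibers : ∀ n → Fiber size n ↔ Fin (coeff f n)
open _Counts_ public

Fiber-≡ : ∀ {A : Set} {size : A → ℕ} {n} {s t : Fiber size n} → proj₁ s ≡ proj₁ t → s ≡ t
Fiber-≡ {s = a , p} {t = .a , q} refl = cong (a ,_) (≡-irrelevant p q)

Counts-↔ : ∀ {A B : Set} {size : A → ℕ} {size′ : B → ℕ} {f} (e : A ↔ B) →
  (∀ a → size′ (Inverse.to e a) ≡ size a) → size′ Counts f → size Counts f
Counts-↔ {size′ = size′} e eq c = counting λ n → fibers c n ∘↔ mk↔ₛ′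
  (λ (a , p) → to a , trans (eq a) p)
  (λ (b , p) → from b , trans (sym (eq (from b))) (trans (cong size′ (strictlyInverseˡ b)) p))
  (λ (b , p) → Fiber-≡ (strictlyInverseˡ b))
  (λ (a , p) → Fiber-≡ (strictlyInverseʳ a))
  where open Inverse e

∑-↔ : ∀ {T : ℕ → ℕ → Set} {f} → (∀ i j → T i j ↔ Fin (f i j)) → ∀ n →
  (Σ ℕ λ i → Σ ℕ λ j → i + j ≡ n × T i j) ↔ Fin (∑⟨ f ⟩ n)
∑-↔ {T} e zero = e 0 0 ∘↔ mk↔ₛ′
  (λ { (zero , zero , refl , t) → t })
  (λ t → 0 , 0 , refl , t)
  (λ _ → refl)
  (λ { (zero , zero , refl , t) → refl })
∑-↔ {T} e (suc n) = ↔-sym +↔⊎ ∘↔ (e 0 (suc n) ⊎-↔ ∑-↔ (e ∘ suc) n) ∘↔ mk↔ₛ′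
  (λ { (zero , j , refl , t) → inj₁ t ; (suc i , j , p , t) → inj₂ (i , j , suc-injective p , t) })
  [ (λ t → 0 , suc n , refl , t) , (λ (i , j , p , t) → suc i , j , cong suc p , t) ]′
  (λ { (inj₁ t) → refl ; (inj₂ (i , j , refl , t)) → refl })
  (λ { (zero , j , refl , t) → refl ; (suc i , j , refl , t) → refl })

Counts-D : ∀ {A : ℕ → Set} {size : ∀ i → A i → ℕ} {F} → (∀ i → size i Counts F i) →
  (λ ((i , a) : Σ ℕ A) → i + size i a) Counts D F
Counts-D {size = size} c = counting λ n → ∑-↔ (λ i j → fibers (c i) j) n ∘↔ mk↔ₛ′
  (λ ((i , a) , p) → i , size i a , p , a , refl)
  (λ { (i , j , p , a , refl) → (i , a) , p })
  (λ { (i , j , p , a , refl) → refl })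
  (λ { ((i , a) , p) → refl })

Counts-× : ∀ {A B : Set} {size : A → ℕ} {size′ : B → ℕ} {f g} → size Counts f → size′ Counts g →
  (λ ((a , b) : A × B) → size a + size′ b) Counts f ⊛ g
Counts-× {size = size} {size′} c d = counting λ n → ∑-↔ (λ i j → ↔-sym *↔× ∘↔ (fibers c i ×-↔ fibers d j)) n ∘↔ mk↔ₛ′
  (λ ((a , b) , p) → size a , size′ b , p , (a , refl) , (b , refl))
  (λ { (i , j , p , (a , refl) , (b , refl)) → (a , b) , p })
  (λ { (i , j , p , (a , refl) , (b , refl)) → refl })
  (λ { ((a , b) , p) → refl })

Counts-⊎ : ∀ {A B : Set} {size : A → ℕ} {size′ : B → ℕ} {f g} → size Counts f → size′ Counts g →
  [ size , size′ ]′ Counts f ⊕ g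
Counts-⊎ c d = counting λ n → ↔-sym +↔⊎ ∘↔ (fibers c n ⊎-↔ fibers d n) ∘↔ mk↔ₛ′
  (λ { (inj₁ a , p) → inj₁ (a , p) ; (inj₂ b , p) → inj₂ (b , p) })
  [ (λ (a , p) → inj₁ a , p) , (λ (b , p) → inj₂ b , p) ]′
  (λ { (inj₁ _) → refl ; (inj₂ _) → refl })
  (λ { (inj₁ _ , _) → refl ; (inj₂ _ , _) → refl })

Counts-q^ : ∀ t → (λ (_ : ⊤) → t) Counts q^ t
Counts-q^ t = counting (go t)
  where
  go : ∀ t n → Fiber (λ (_ : ⊤) → t) n ↔ Fin (coeff (q^ t) n)
  go zero    zero    = ↔-sym 1↔⊤ ∘↔ mk↔ₛ′ proj₁ (_, refl) (λ _ → refl) (λ { (_ , refl) → refl })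
  go zero    (suc n) = ↔-sym 0↔⊥ ∘↔ mk↔ₛ′ (λ { (_ , ()) }) (λ ()) (λ ()) (λ { (_ , ()) })
  go (suc t) zero    = ↔-sym 0↔⊥ ∘↔ mk↔ₛ′ (λ { (_ , ()) }) (λ ()) (λ ()) (λ { (_ , ()) })
  go (suc t) (suc n) = go t n ∘↔ mk↔ₛ′
    (λ (_ , p) → _ , suc-injective p) (λ (_ , p) → _ , cong suc p)
    (λ { (_ , refl) → refl }) (λ { (_ , refl) → refl })

Counts-shift : ∀ {A : Set} {size : A → ℕ} {f} t → size Counts f → (λ a → t + size a) Counts q^ t ⊛ f
Counts-shift t c = Counts-↔
  (mk↔ₛ′ (tt ,_) proj₂ (λ _ → refl) (λ _ → refl)) (λ _ → refl) (Counts-× (Counts-q^ t) c)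

Counts-geo : ∀ t → (λ i → i * suc t) Counts geo t
Counts-geo t = Counts-↔ (mk↔ₛ′ (_, tt) proj₁ (λ _ → refl) (λ _ → refl))
  (λ i → sym (*-suc i t)) (Counts-D λ i → Counts-q^ (i * t))

-- The entries of the vector are the multiplicities of b + l , … , b + 1.
weight : ∀ b {l} → Vec ℕ l → ℕ
weight b []            = 0
weight b {suc l} (i ∷ v) = i * suc (b + l) + weight b v

Counts-weight : ∀ b l → weight b {l} Counts ag b l
Counts-weight b zero = Counts-↔ (mk↔ₛ′ (λ _ → tt) (λ _ → []) (λ _ → refl) (λ { [] → refl }))
  (λ { [] → refl }) (Counts-q^ 0)
Counts-weight b (suc l) = Counts-↔
  (mk↔ₛ′ (λ { (i ∷ v) → i , v }) (λ (i , v) → i ∷ v) (λ _ → refl) (λ { (i ∷ v) → refl }))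
  (λ { (i ∷ v) → refl }) (Counts-× (Counts-geo (b + l)) (Counts-weight b l))

Box : ℕ → ℕ → Set
Box l j = Σ (Vec ℕ l) λ v → Vec.sum v ≤ j

Box-≡ : ∀ {l j} {s t : Box l j} → proj₁ s ≡ proj₁ t → s ≡ t
Box-≡ {s = v , p} {t = .v , q} refl = cong (v ,_) (≤-irrelevant p q)

-- The first entry is the multiplicity of the largest admissible part. Either it is zero, or one
-- copy is removed, which lowers the bound on the number of parts.
Counts-box : ∀ l j → (λ ((v , _) : Box l j) → weight 0 v) Counts box l j
Counts-box zero j = Counts-↔ (mk↔ₛ′ (λ _ → tt) (λ _ → [] , z≤n) (λ _ → refl) (λ { ([] , _) → Box-≡ refl }))
  (λ { ([] , _) → refl }) (Counts-q^ 0)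
Counts-box (suc l) zero = Counts-↔
  (mk↔ₛ′ (λ { (zero ∷ v , p) → v , p ; (suc i ∷ v , ()) }) (λ (v , p) → zero ∷ v , p)
         (λ _ → refl) (λ { (zero ∷ v , p) → refl ; (suc i ∷ v , ()) }))
  (λ { (zero ∷ v , p) → refl ; (suc i ∷ v , ()) }) (Counts-box l zero)
Counts-box (suc l) (suc j) = Counts-↔
  (mk↔ₛ′ (λ { (zero ∷ v , p) → inj₁ (v , p) ; (suc i ∷ v , s≤s p) → inj₂ (i ∷ v , p) })
         [ (λ (v , p) → zero ∷ v , p) , (λ { (i ∷ v , p) → suc i ∷ v , s≤s p }) ]′
         (λ { (inj₁ _) → refl ; (inj₂ (i ∷ v , p)) → refl })
         (λ { (zero ∷ v , p) → refl ; (suc i ∷ v , s≤s p) → refl }))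
  (λ { (zero ∷ v , p) → refl ; (suc i ∷ v , s≤s p) → cong suc (sym (+-assoc l (i * suc l) (weight 0 v))) })
  (Counts-⊎ (Counts-box l (suc j)) (Counts-shift (suc l) (Counts-box (suc l) j)))

-- Partitions as vectors of multiplicities or of differences

-- The filtered list and the image of `Fin (coeff f n)` under `φ` are duplicate-free with the same
-- members, hence permutations of each other.
count-bijection : ∀ {A B : Set} {P : A → Set} {size : B → ℕ} {f} {xs : List A} (P? : Decidable P) →
  Unique xs → size Counts f → (φ : B → A) → (∀ {b c} → φ b ≡ φ c → b ≡ c) → ∀ n →
  (∀ b → size b ≡ n → φ b ∈ xs × P (φ b)) →
  (∀ {x} → x ∈ xs → P x → ∃[ b ] size b ≡ n × φ b ≡ x) →
  count P? xs ≡ coeff f n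
count-bijection {P = P} {size} {f} {xs} P? unique c φ φ-injective n sound complete =
  trans (↭-length (∼bag⇒↭ (unique∧set⇒bag (Unique.filter⁺ P? unique) unique′
    λ {x} → mk⇔ (forth x) (back x))))
  (trans (length-map _ (allFin (coeff f n))) (length-tabulate {n = coeff f n} (λ i → i)))
  where
  open Inverse (fibers c n)

  object : Fin (coeff f n) → _
  object i = φ (proj₁ (from i))

  object-injective : ∀ {i j} → object i ≡ object j → i ≡ j
  object-injective {i} {j} eq = trans (sym (strictlyInverseˡ i))
    (trans (cong to (Fiber-≡ (φ-injective eq))) (strictlyInverseˡ j))

  unique′ : Unique (map object (allFin (coeff f n)))
  unique′ = Unique.map⁺ object-injective (Unique.allFin⁺ _)

  forth : ∀ x → x ∈ filter P? xs → x ∈ map object (allFin (coeff f n))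
  forth x x∈ with ∈-filter⁻ P? {xs = xs} x∈
  ... | x∈xs , px with complete x∈xs px
  ...   | b , eq , refl = subst (_∈ map object (allFin (coeff f n)))
    (cong (φ ∘ proj₁) (strictlyInverseʳ (b , eq))) (∈-map⁺ object (∈-allFin (to (b , eq))))

  back : ∀ x → x ∈ map object (allFin (coeff f n)) → x ∈ filter P? xs
  back x x∈ with ∈-map⁻ object x∈
  ... | i , _ , refl with from i
  ...   | b , eq with sound b eq
  ...     | φb∈ , pφb = ∈-filter⁺ P? φb∈ pφb

module _ {P : ℕ → Set} (P? : Decidable P) where

  count-++ : ∀ xs ys → count P? (xs ++ ys) ≡ count P? xs + count P? ys
  count-++ xs ys = trans (cong length (filter-++ P? xs ys)) (length-++ (filter P? xs))

  count-reverse : ∀ xs → count P? (reverse xs) ≡ count P? xs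
  count-reverse []       = refl
  count-reverse (x ∷ xs) = begin
    count P? (reverse (x ∷ xs))              ≡⟨ cong (count P?) (unfold-reverse x xs) ⟩
    count P? (reverse xs ++ x ∷ [])          ≡⟨ count-++ (reverse xs) (x ∷ []) ⟩
    count P? (reverse xs) + count P? (x ∷ []) ≡⟨ +-comm (count P? (reverse xs)) _ ⟩
    count P? (x ∷ []) + count P? (reverse xs) ≡⟨ cong (count P? (x ∷ []) +_) (count-reverse xs) ⟩
    count P? (x ∷ []) + count P? xs          ≡⟨ count-++ (x ∷ []) xs ⟨
    count P? (x ∷ xs)                        ∎
    where open ≡-Reasoning

  count-all : ∀ {xs} → All P xs → count P? xs ≡ length xs
  count-all ps = cong length (filter-all P? ps)

  count-none : ∀ {xs} → All (λ x → ¬ P x) xs → count P? xs ≡ 0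
  count-none ps = cong length (filter-none P? ps)

sum-reverse : ∀ xs → sum (reverse xs) ≡ sum xs
sum-reverse xs = sum-↭ (↭-reverse xs)

sum-replicate : ∀ i s → sum (replicate i s) ≡ i * s
sum-replicate zero    s = refl
sum-replicate (suc i) s = cong (s +_) (sum-replicate i s)

All-reverse : ∀ {P : ℕ → Set} {xs} → All P xs → All P (reverse xs)
All-reverse {xs = xs} = All-resp-↭ (↭-sym (↭-reverse xs))

All-reverse⁻ : ∀ {P : ℕ → Set} xs → All P (reverse xs) → All P xs
All-reverse⁻ xs = All-resp-↭ (↭-reverse xs)

AllPairs-reverse : ∀ {R : ℕ → ℕ → Set} {xs} → AllPairs R xs → AllPairs (flip R) (reverse xs)
AllPairs-reverse []                      = []
AllPairs-reverse {xs = x ∷ xs} (rs ∷ ps) = subst (AllPairs _) (sym (unfold-reverse x xs))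
  (AllPairs.++⁺ (AllPairs-reverse ps) ([] ∷ []) (All.map (_∷ []) (All-reverse rs)))

AllPairs-++⁻ : ∀ {R : ℕ → ℕ → Set} xs {ys} → AllPairs R (xs ++ ys) →
  AllPairs R xs × AllPairs R ys
AllPairs-++⁻ []       ps       = [] , ps
AllPairs-++⁻ (x ∷ xs) (rs ∷ ps) =
  let ps₁ , ps₂ = AllPairs-++⁻ xs ps in All.++⁻ˡ xs rs ∷ ps₁ , ps₂

-- Both lists are split at the first entry that does not satisfy P.
++-injective : ∀ {P : ℕ → Set} {xs xs′} ys ys′ → All P xs → All P xs′ →
  All (λ y → ¬ P y) (take 1 ys) → All (λ y → ¬ P y) (take 1 ys′) →
  xs ++ ys ≡ xs′ ++ ys′ → xs ≡ xs′ × ys ≡ ys′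
++-injective ys       ys′      []       []        _        _        eq   = refl , eq
++-injective (_ ∷ _)  ys′      []       (p ∷ _)   (¬p ∷ _) _        refl = contradiction p ¬p
++-injective ys       (_ ∷ _)  (p ∷ _)  []        _        (¬p ∷ _) refl = contradiction p ¬p
++-injective ys       ys′      (_ ∷ ps) (_ ∷ ps′) ns       ns′      eq   with ∷-injective eq
... | refl , eq′ = map₁ (cong (_ ∷_)) (++-injective ys ys′ ps ps′ ns ns′ eq′)

-- Descending lists of parts in (b , b + l], by multiplicities.
mult : ∀ b {l} → Vec ℕ l → List ℕ
mult b           []      = []
mult b {suc l} (i ∷ v) = replicate i (suc (b + l)) ++ mult b v

mult-sum : ∀ b {l} (v : Vec ℕ l) → sum (mult b v) ≡ weight b v
mult-sum b           []      = refl
mult-sum b {suc l} (i ∷ v) = trans (sum-++ (replicate i (suc (b + l))) (mult b v))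
  (cong₂ _+_ (sum-replicate i _) (mult-sum b v))

mult-above : ∀ b {l} (v : Vec ℕ l) → All (b <_) (mult b v)
mult-above b           []      = []
mult-above b {suc l} (i ∷ v) = All.++⁺ (All.replicate⁺ i (s≤s (m≤m+n b l))) (mult-above b v)

mult-below : ∀ b {l} (v : Vec ℕ l) → All (_≤ b + l) (mult b v)
mult-below b           []      = []
mult-below b {suc l} (i ∷ v) = All.++⁺ (All.replicate⁺ i (≤-reflexive (sym (+-suc b l))))
  (All.map (λ le → ≤-trans le (+-monoʳ-≤ b (n≤1+n l))) (mult-below b v))

replicate-sorted : ∀ {R : ℕ → ℕ → Set} i {s} → R s s → AllPairs R (replicate i s)
replicate-sorted zero    r = []
replicate-sorted (suc i) r = All.replicate⁺ i r ∷ replicate-sorted i r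

++-descending : ∀ {t xs ys} → AllPairs _≥_ xs → AllPairs _≥_ ys → All (t ≤_) xs → All (_≤ t) ys →
  AllPairs _≥_ (xs ++ ys)
++-descending pxs pys lo hi =
  AllPairs.++⁺ pxs pys (All.map (λ t≤x → All.map (λ y≤t → ≤-trans y≤t t≤x) hi) lo)

mult-descending : ∀ b {l} (v : Vec ℕ l) → AllPairs _≥_ (mult b v)
mult-descending b           []      = []
mult-descending b {suc l} (i ∷ v) = ++-descending (replicate-sorted i ≤-refl) (mult-descending b v)
  (All.replicate⁺ i ≤-refl) (All.map m≤n⇒m≤1+n (mult-below b v))

replicate-injective : ∀ i j {s : ℕ} → replicate i s ≡ replicate j s → i ≡ j
replicate-injective i j {s} eq =
  trans (sym (length-replicate i)) (trans (cong length eq) (length-replicate j))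

mult-injective : ∀ b {l} (v w : Vec ℕ l) → mult b v ≡ mult b w → v ≡ w
mult-injective b           []      []      _  = refl
mult-injective b {suc l} (i ∷ v) (j ∷ w) eq =
  let eq₁ , eq₂ = ++-injective {P = _≡ suc (b + l)} (mult b v) (mult b w)
                    (All.replicate⁺ i refl) (All.replicate⁺ j refl)
                    (All.take⁺ 1 (All.map (<⇒≢ ∘ s≤s) (mult-below b v)))
                    (All.take⁺ 1 (All.map (<⇒≢ ∘ s≤s) (mult-below b w))) eq
  in cong₂ _∷_ (replicate-injective i j eq₁) (mult-injective b v w eq₂)

mult-surjective : ∀ b l p → AllPairs _≥_ p → All (b <_) p → All (_≤ b + l) p →
  ∃[ v ] mult b {l} v ≡ p
mult-surjective b zero []      _ _         _         = [] , refl
mult-surjective b zero (x ∷ p) _ (b<x ∷ _) (x≤b ∷ _) =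
  contradiction (subst (x ≤_) (+-identityʳ b) x≤b) (<⇒≱ b<x)
mult-surjective b (suc l) = go
  where
  go : ∀ p → AllPairs _≥_ p → All (b <_) p → All (_≤ b + suc l) p → ∃[ v ] mult b {suc l} v ≡ p
  go []      _         _          _          =
    let v , eq = mult-surjective b l [] [] [] [] in 0 ∷ v , eq
  go (x ∷ p) (xs ∷ ps) (lo ∷ los) (hi ∷ his) with x ≟ suc (b + l)
  ... | no x≢ =
    let v , eq = mult-surjective b l (x ∷ p) (xs ∷ ps) (lo ∷ los)
                   (x≤ ∷ All.map (λ y≤x → ≤-trans y≤x x≤) xs)
    in 0 ∷ v , eq
    where
    x≤ : x ≤ b + l
    x≤ = s≤s⁻¹ (≤∧≢⇒< (subst (x ≤_) (+-suc b l) hi) x≢)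
  ... | yes refl with go p ps los his
  ...   | i ∷ v , eq = suc i ∷ v , cong (_ ∷_) eq

-- Ascending lists of length m with all parts ≥ s, by successive differences.
asc : ℕ → ∀ {m} → Vec ℕ m → List ℕ
asc s []      = []
asc s (i ∷ v) = s + i ∷ asc (s + i) v

-- A difference raises its own entry and all later ones, so the first of m + 1 differences counts m
-- + 1 times. This is its weight as the multiplicity of the part m + 1 in the conjugate partition.
asc-sum : ∀ s {m} (v : Vec ℕ m) → sum (asc s v) ≡ m * s + weight 0 v
asc-sum s [] = refl
asc-sum s {suc m} (i ∷ v) = trans (cong (s + i +_) (asc-sum (s + i) v)) (lemma i s m (weight 0 v))
  where
  lemma : ∀ i s m w → s + i + (m * (s + i) + w) ≡ suc m * s + (i * suc m + w)
  lemma = solve-∀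

asc-above : ∀ s {m} (v : Vec ℕ m) → All (s ≤_) (asc s v)
asc-above s []      = []
asc-above s (i ∷ v) = m≤m+n s i ∷ All.map (≤-trans (m≤m+n s i)) (asc-above (s + i) v)

asc-ascending : ∀ s {m} (v : Vec ℕ m) → AllPairs _≤_ (asc s v)
asc-ascending s []      = []
asc-ascending s (i ∷ v) = asc-above (s + i) v ∷ asc-ascending (s + i) v

asc-length : ∀ s {m} (v : Vec ℕ m) → length (asc s v) ≡ m
asc-length s []      = refl
asc-length s (i ∷ v) = cong suc (asc-length (s + i) v)

asc-injective : ∀ s {m} (v w : Vec ℕ m) → asc s v ≡ asc s w → v ≡ w
asc-injective s []      []      _  = refl
asc-injective s (i ∷ v) (j ∷ w) eq with ∷-injective eq
... | eq₁ , eq₂ with +-cancelˡ-≡ s i j eq₁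
...   | refl = cong (i ∷_) (asc-injective (s + i) v w eq₂)

asc-surjective : ∀ s {p} → AllPairs _≤_ p → All (s ≤_) p → ∃[ m ] ∃[ v ] asc s {m} v ≡ p
asc-surjective s []        []       = 0 , [] , refl
asc-surjective s (xs ∷ ps) (lo ∷ _) with m≤n⇒∃[o]m+o≡n lo
... | i , refl = let m , v , eq = asc-surjective (s + i) ps xs in suc m , i ∷ v , cong (_ ∷_) eq

-- Counting partitions and cutting them at a threshold

IsPartition : List ℕ → Set
IsPartition p = AllPairs _≥_ p × All (1 ≤_) p

∈-partitions⁺ : ∀ {n p} → IsPartition p → sum p ≡ n → p ∈ partitions n
∈-partitions⁺ {n} (desc , pos) eq =
  ∈-filter⁺ (linked? _) (compositions-complete n (pos , eq)) (AllPairs⇒Linked desc)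

∈-partitions⁻ : ∀ {n p} → p ∈ partitions n → IsPartition p × sum p ≡ n
∈-partitions⁻ {n} p∈ with ∈-filter⁻ (linked? _) {xs = compositions n} p∈
... | p∈′ , desc with All.lookup (compositions-sound n) p∈′
...   | pos , eq = (Linked⇒AllPairs (flip ≤-trans) desc , pos) , eq

count-partitions : ∀ {B : Set} {P : List ℕ → Set} {size : B → ℕ} {f} (P? : Decidable P) →
  size Counts f → (φ : B → List ℕ) → (∀ {b c} → φ b ≡ φ c → b ≡ c) →
  (∀ b → sum (φ b) ≡ size b) → (∀ b → IsPartition (φ b)) → (∀ b → P (φ b)) →
  (∀ {p} → IsPartition p → P p → ∃[ b ] φ b ≡ p) →
  ∀ n → count P? (partitions n) ≡ coeff f n
count-partitions P? c φ φ-injective φ-sum φ-partition φ-P complete n =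
  count-bijection P? (Unique.filter⁺ (linked? _) (compositions-unique n)) c φ φ-injective n
    (λ b eq → ∈-partitions⁺ (φ-partition b) (trans (φ-sum b) eq) , φ-P b)
    λ p∈ pp → let part , sum≡ = ∈-partitions⁻ p∈
                  b , eq = complete part pp
              in b , trans (sym (φ-sum b)) (trans (cong sum eq) sum≡) , eq

-- The parts above `t` are kept in ascending order, the form in which `asc` encodes them.
record Split (t : ℕ) (p : List ℕ) : Set where
  constructor split
  field
    upper lower : List ℕ
    p≡        : reverse upper ++ lower ≡ p
    ascending : AllPairs _≤_ upper
    above     : All (t <_) upper
    descending : AllPairs _≥_ lower
    below     : All (_≤ t) lower

split-at : ∀ t {p} → AllPairs _≥_ p → Split t p
split-at t [] = split [] [] refl [] [] [] []
split-at t {x ∷ p} (xs ∷ ps) with t <? x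
... | no t≮x = split [] (x ∷ p) refl [] [] (xs ∷ ps)
  (x≤t ∷ All.map (λ y≤x → ≤-trans y≤x x≤t) xs)
  where x≤t = ≮⇒≥ t≮x
... | yes t<x with split-at t ps
...   | split upper lower refl ascending above descending below =
  split (upper ++ x ∷ []) lower (cong (_++ lower) (reverse-++ upper (x ∷ [])))
    (AllPairs.++⁺ ascending ([] ∷ []) (All.map (_∷ []) (All-reverse⁻ upper (All.++⁻ˡ (reverse upper) xs))))
    (All.++⁺ above (t<x ∷ [])) descending below

-- The partitions counted by M

module _ (t : ℕ) {U L : List ℕ} where

  join-partition : AllPairs _≤_ U → All (t <_) U → AllPairs _≥_ L → All (_≤ t) L → All (1 ≤_) L →
    IsPartition (reverse U ++ L)
  join-partition asc above desc below pos =
    ++-descending (AllPairs-reverse asc) desc (All-reverse (All.map <⇒≤ above)) below ,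
    All.++⁺ (All-reverse (All.map (≤-trans (s≤s z≤n)) above)) pos

  join-injective : ∀ {U′ L′} → All (t <_) U → All (t <_) U′ → All (_≤ t) L → All (_≤ t) L′ →
    reverse U ++ L ≡ reverse U′ ++ L′ → U ≡ U′ × L ≡ L′
  join-injective {L′ = L′} above above′ below below′ eq =
    map₁ reverse-injective (++-injective L L′ (All-reverse above) (All-reverse above′)
      (All.take⁺ 1 (All.map ≤⇒≯ below)) (All.take⁺ 1 (All.map ≤⇒≯ below′)) eq)

join-sum : ∀ U L → sum (reverse U ++ L) ≡ sum U + sum L
join-sum U L = trans (sum-++ (reverse U) L) (cong (_+ sum L) (sum-reverse U))

join-count : ∀ {P : ℕ → Set} (P? : Decidable P) U L → count P? (reverse U ++ L) ≡ count P? U + count P? L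
join-count P? U L = trans (count-++ P? (reverse U) L) (cong (_+ count P? L) (count-reverse P? U))

join-∈⁻ : ∀ {i} (U L : List ℕ) → i ∉ U → i ∈ reverse U ++ L → i ∈ L
join-∈⁻ U L i∉U i∈ with ∈-++⁻ (reverse U) i∈
... | inj₁ i∈U = contradiction (Any.reverse⁻ i∈U) i∉U
... | inj₂ i∈L = i∈L

module _ (k : ℕ) {U L : List ℕ} (above : All (k <_) U) (below : All (_< k) L) where

  join-count-> : count (_>? k) (reverse U ++ L) ≡ length U
  join-count-> = begin
    count (_>? k) (reverse U ++ L)        ≡⟨ join-count (_>? k) U L ⟩
    count (_>? k) U + count (_>? k) L     ≡⟨ cong₂ _+_ (count-all (_>? k) above)
                                                       (count-none (_>? k) (All.map <⇒≯ below)) ⟩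
    length U + 0                          ≡⟨ +-identityʳ _ ⟩
    length U                              ∎
    where open ≡-Reasoning

  join-count-< : count (_<? k) (reverse U ++ L) ≡ length L
  join-count-< = begin
    count (_<? k) (reverse U ++ L)        ≡⟨ join-count (_<? k) U L ⟩
    count (_<? k) U + count (_<? k) L     ≡⟨ cong₂ _+_ (count-none (_<? k) (All.map <⇒≯ above))
                                                       (count-all (_<? k) below) ⟩
    length L                              ∎
    where open ≡-Reasoning

∉-above : ∀ {i} {xs : List ℕ} → All (i <_) xs → i ∉ xs
∉-above above i∈ = <-irrefl refl (All.lookup above i∈)

∉-below : ∀ {i} {xs : List ℕ} → All (_< i) xs → i ∉ xs
∉-below below i∈ = <-irrefl refl (All.lookup below i∈)

mult-length : ∀ b {l} (v : Vec ℕ l) → length (mult b v) ≡ Vec.sum v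
mult-length b           []      = refl
mult-length b {suc l} (i ∷ v) = trans (length-++ (replicate i _))
  (cong₂ _+_ (length-replicate i) (mult-length b v))

triangle : ℕ → ℕ
triangle zero    = 0
triangle (suc l) = suc l + triangle l

weight-map-suc : ∀ {l} (v : Vec ℕ l) → weight 0 (Vec.map suc v) ≡ triangle l + weight 0 v
weight-map-suc []                = refl
weight-map-suc {suc l} (i ∷ v) = trans (cong (suc i * suc l +_) (weight-map-suc v))
  (lemma i l (triangle l) (weight 0 v))
  where
  lemma : ∀ i l t w → suc i * suc l + (t + w) ≡ suc l + t + (i * suc l + w)
  lemma = solve-∀

sum-map-suc : ∀ {l} (v : Vec ℕ l) → Vec.sum (Vec.map suc v) ≡ l + Vec.sum v
sum-map-suc []                = refl
sum-map-suc {suc l} (i ∷ v) = cong suc (trans (cong (i +_) (sum-map-suc v)) (lemma i l (Vec.sum v)))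
  where
  lemma : ∀ i l s → i + (l + s) ≡ l + (i + s)
  lemma = solve-∀

map-suc-injective : ∀ {l} (v w : Vec ℕ l) → Vec.map suc v ≡ Vec.map suc w → v ≡ w
map-suc-injective []      []      _  = refl
map-suc-injective (i ∷ v) (j ∷ w) eq =
  cong₂ _∷_ (suc-injective (cong Vec.head eq)) (map-suc-injective v w (cong Vec.tail eq))

-- The partitions whose set of parts is exactly 1, ..., l: raising all multiplicities by one makes
-- them positive.
full : ∀ {l} → Vec ℕ l → List ℕ
full v = mult 0 (Vec.map suc v)

full-below : ∀ {l} (v : Vec ℕ l) → All (_≤ l) (full v)
full-below v = mult-below 0 (Vec.map suc v)

full-positive : ∀ {l} (v : Vec ℕ l) → All (1 ≤_) (full v)
full-positive v = mult-above 0 (Vec.map suc v)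

full-descending : ∀ {l} (v : Vec ℕ l) → AllPairs _≥_ (full v)
full-descending v = mult-descending 0 (Vec.map suc v)

full-sum : ∀ {l} (v : Vec ℕ l) → sum (full v) ≡ triangle l + weight 0 v
full-sum v = trans (mult-sum 0 (Vec.map suc v)) (weight-map-suc v)

full-length : ∀ {l} (v : Vec ℕ l) → length (full v) ≡ l + Vec.sum v
full-length v = trans (mult-length 0 (Vec.map suc v)) (sum-map-suc v)

full-∈ : ∀ {l i} (v : Vec ℕ l) → 1 ≤ i → i ≤ l → i ∈ full v
full-∈ []                1≤i i≤0 = contradiction (≤-trans 1≤i i≤0) λ ()
full-∈ {suc l} {i} (j ∷ v) 1≤i i≤l with i ≟ suc l
... | yes refl = here refl
... | no  i≢   = ∈-++⁺ʳ (replicate (suc j) (suc l)) (full-∈ v 1≤i (s≤s⁻¹ (≤∧≢⇒< i≤l i≢)))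

full-surjective : ∀ l {p} → AllPairs _≥_ p → All (1 ≤_) p → All (_≤ l) p →
  (∀ {i} → 1 ≤ i → i ≤ l → i ∈ p) → ∃[ v ] full {l} v ≡ p
full-surjective l desc pos below parts with mult-surjective 0 l _ desc pos below
... | v , refl = let w , eq = go v parts in w , cong (mult 0) eq
  where
  go : ∀ {l} (v : Vec ℕ l) → (∀ {i} → 1 ≤ i → i ≤ l → i ∈ mult 0 v) → ∃[ w ] Vec.map suc w ≡ v
  go []                    parts = [] , refl
  go {suc l} (zero  ∷ v) parts =
    contradiction (parts (s≤s z≤n) ≤-refl) (∉-below (All.map s≤s (mult-below 0 v)))
  go {suc l} (suc j ∷ v) parts = let w , eq = go v parts′ in j ∷ w , cong (suc j ∷_) eq
    where
    parts′ : ∀ {i} → 1 ≤ i → i ≤ l → i ∈ mult 0 v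
    parts′ 1≤i i≤l with ∈-++⁻ (replicate (suc j) (suc l)) (parts 1≤i (m≤n⇒m≤1+n i≤l))
    ... | inj₁ i∈ = contradiction (s≤s i≤l) (<-irrefl (All.lookup (All.replicate⁺ {P = λ x → x ≡ suc l} (suc j) refl) i∈))
    ... | inj₂ i∈ = i∈

full-injective : ∀ {l} (v w : Vec ℕ l) → full v ≡ full w → v ≡ w
full-injective v w eq = map-suc-injective v w (mult-injective 0 _ _ eq)

module _ (l : ℕ) where
  private
    k = suc l

    -- There are `k + j` parts above `k`, given by the differences `ds`, and `l + Vec.sum v` parts
    -- below `k`. With `k = suc l`, having more of the former means `Vec.sum v ≤ j`, which is why
    -- `v` lies in a box.
    Object : Set
    Object = Σ ℕ λ j → Vec ℕ (k + j) × Box l j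

    size : Object → ℕ
    size (j , ds , v , _) = triangle l + (j + (k + k * (k + j) + (weight 0 ds + weight 0 v)))

    φ : Object → List ℕ
    φ (j , ds , v , _) = reverse (asc (suc k) ds) ++ full v

    above : ∀ {m} (ds : Vec ℕ m) → All (l <_) (asc (suc k) ds)
    above ds = All.map (<-trans (n<1+n l)) (asc-above (suc k) ds)

    φ-injective : ∀ {b c} → φ b ≡ φ c → b ≡ c
    φ-injective {j , ds , v , p} {j′ , ds′ , v′ , p′} eq
      with join-injective l (above ds) (above ds′) (full-below v) (full-below v′) eq
    ... | eq₁ , eq₂ with +-cancelˡ-≡ k j j′ (trans (sym (asc-length (suc k) ds))
                           (trans (cong length eq₁) (asc-length (suc k) ds′)))
    ... | refl with asc-injective (suc k) ds ds′ eq₁ | full-injective v v′ eq₂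
    ... | refl | refl = cong (λ b → j , ds , b) (Box-≡ refl)

    φ-sum : ∀ b → sum (φ b) ≡ size b
    φ-sum (j , ds , v , _) = begin
      sum (reverse (asc (suc k) ds) ++ full v)
        ≡⟨ join-sum (asc (suc k) ds) (full v) ⟩
      sum (asc (suc k) ds) + sum (full v)
        ≡⟨ cong₂ _+_ (asc-sum (suc k) ds) (full-sum v) ⟩
      (k + j) * suc k + weight 0 ds + (triangle l + weight 0 v)
        ≡⟨ lemma l j (weight 0 ds) (triangle l) (weight 0 v) ⟩
      triangle l + (j + (k + k * (k + j) + (weight 0 ds + weight 0 v))) ∎
      where
      open ≡-Reasoning
      lemma : ∀ l j d t w → (suc l + j) * suc (suc l) + d + (t + w) ≡
                            t + (j + (suc l + suc l * (suc l + j) + (d + w)))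
      lemma = solve-∀

    φ-partition : ∀ b → IsPartition (φ b)
    φ-partition (j , ds , v , _) = join-partition l (asc-ascending (suc k) ds) (above ds)
      (full-descending v) (full-below v) (full-positive v)

    Admissible : List ℕ → Set
    Admissible p = LeastNonPart k p × count (_>? k) p > count (_<? k) p

    φ-admissible : ∀ b → Admissible (φ b)
    φ-admissible (j , ds , v , v≤j) = (s≤s z≤n , k∉ , parts) , more
      where
      U = asc (suc k) ds
      U>k = asc-above (suc k) ds
      L<k = All.map s≤s (full-below v)

      k∉ : k ∉ reverse U ++ full v
      k∉ k∈ = ∉-below L<k (join-∈⁻ U (full v) (∉-above U>k) k∈)

      parts : AllBelowAreParts k (reverse U ++ full v)
      parts (s≤s i≤l) 1≤i = ∈-++⁺ʳ (reverse U) (full-∈ v 1≤i i≤l)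

      more : count (_<? k) (reverse U ++ full v) < count (_>? k) (reverse U ++ full v)
      more = subst₂ _<_ (sym (trans (join-count-< k U>k L<k) (full-length v)))
        (sym (trans (join-count-> k U>k L<k) (asc-length (suc k) ds))) (s≤s (+-monoʳ-≤ l v≤j))

    φ-complete : ∀ {p} → IsPartition p → Admissible p → ∃[ b ] φ b ≡ p
    φ-complete {p} (desc , pos) ((_ , k∉ , parts) , more) with split-at k desc
    ... | split U L refl ascending U>k descending L≤k
      with full-surjective l descending (All.++⁻ʳ (reverse U) pos)
             (All.tabulate λ i∈ → s≤s⁻¹ (≤∧≢⇒< (All.lookup L≤k i∈) λ { refl → k∉ (∈-++⁺ʳ (reverse U) i∈) }))
             (λ 1≤i i≤l → join-∈⁻ U L (∉-above (All.map (<-trans (s≤s i≤l)) U>k)) (parts (s≤s i≤l) 1≤i))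
    -- The comparison of the two counts gives in particular `k ≤ length U`, and the difference is
    -- the witness `j`.
    ... | v , refl with many | m≤n⇒∃[o]m+o≡n (≤-trans (s≤s (m≤m+n l (Vec.sum v))) many)
      where
      L<k = All.map s≤s (full-below v)
      many : l + Vec.sum v < length U
      many = subst₂ _<_ (trans (join-count-< k U>k L<k) (full-length v)) (join-count-> k U>k L<k) more
    ... | many | j , eq with asc-surjective (suc k) ascending U>k
    ... | _ , ds , refl with trans eq (asc-length (suc k) ds)
    ... | refl = (j , ds , v , v≤j) , refl
      where
      v≤j : Vec.sum v ≤ j
      v≤j = +-cancelˡ-≤ l _ _ (s≤s⁻¹ (≤-trans many (≤-reflexive (sym eq))))

  M-coeff : ∀ n → M k n ≡ coeff (q^ (triangle l) ⊛ L l k) n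
  M-coeff = count-partitions (λ p → leastNonPart? k p ×-dec (count (_>? k) p >? count (_<? k) p))
    (Counts-shift (triangle l) (Counts-D λ j → Counts-shift (k + k * (k + j))
      (Counts-× (Counts-weight 0 (k + j)) (Counts-box l j))))
    φ φ-injective φ-sum φ-partition φ-admissible φ-complete

-- The partitions counted by P̃

-- If the head is not `s`, it is larger, and so are all later entries; then `s` does not occur at
-- all.
ascending-prefix : ∀ m {s xs} → AllPairs _≤_ xs → All (s ≤_) xs → m ≤ multiplicity s xs →
  ∃[ ys ] replicate m s ++ ys ≡ xs
ascending-prefix zero    {xs = xs} _ _ _ = xs , refl
ascending-prefix (suc m) {s} {x ∷ xs} (ps ∷ pxs) (s≤x ∷ los) m≤ with x ≟ s
... | yes refl = let ys , eq = ascending-prefix m pxs los (s≤s⁻¹ (subst (suc m ≤_) (cong length (filter-accept (_≟ s) refl)) m≤))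
                 in ys , cong (s ∷_) eq
... | no x≢s   = contradiction (subst (suc m ≤_) (count-none (_≟ s) {x ∷ xs} (x≢s ∷ All.map absent ps)) m≤) λ ()
  where
  absent : ∀ {y} → x ≤ y → y ≢ s
  absent x≤y refl = x≢s (≤-antisym x≤y s≤x)

module _ (l : ℕ) where
  private
    k = suc l

    -- The smallest part above `k` is `suc (k + r)`. It is repeated `suc k` times, followed by `j`
    -- further parts at least as large, with differences `ds`; `v` holds the multiplicities of 1,
    -- ..., k, each reduced by one.
    Object : Set
    Object = Σ ℕ λ r → Vec ℕ k × Σ ℕ (Vec ℕ)

    size : Object → ℕ
    size (r , v , j , ds) = triangle l +
      (r + (k + (suc k * suc k + r * k) + (weight 0 v + (j + ((k + r) * j + weight 0 ds)))))

    upper : ∀ (r : ℕ) {j} → Vec ℕ j → List ℕ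
    upper r ds = replicate (suc k) (suc (k + r)) ++ asc (suc (k + r)) ds

    φ : Object → List ℕ
    φ (r , v , j , ds) = reverse (upper r ds) ++ full v

    upper-≥ : ∀ r {j} (ds : Vec ℕ j) → All (suc (k + r) ≤_) (upper r ds)
    upper-≥ r ds = All.++⁺ (All.replicate⁺ (suc k) ≤-refl) (asc-above _ ds)

    upper-> : ∀ r {j} (ds : Vec ℕ j) → All (k <_) (upper r ds)
    upper-> r ds = All.map (≤-trans (s≤s (m≤m+n k r))) (upper-≥ r ds)

    φ-injective : ∀ {b c} → φ b ≡ φ c → b ≡ c
    φ-injective {r , v , j , ds} {r′ , v′ , j′ , ds′} eq
      with join-injective k (upper-> r ds) (upper-> r′ ds′) (full-below v) (full-below v′) eq
    ... | eq₁ , eq₂ with +-cancelˡ-≡ (suc k) r r′ (∷-injectiveˡ eq₁) | full-injective v v′ eq₂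
    ... | refl | refl with ++-cancelˡ (replicate (suc k) (suc (k + r))) _ _ eq₁
    ... | eq₃ with trans (sym (asc-length _ ds)) (trans (cong length eq₃) (asc-length _ ds′))
    ... | refl = cong (λ ds → r , v , j , ds) (asc-injective (suc (k + r)) ds ds′ eq₃)

    φ-sum : ∀ b → sum (φ b) ≡ size b
    φ-sum (r , v , j , ds) = begin
      sum (reverse (upper r ds) ++ full v)
        ≡⟨ join-sum (upper r ds) (full v) ⟩
      sum (upper r ds) + sum (full v)
        ≡⟨ cong₂ _+_ (trans (sum-++ (replicate (suc k) (suc (k + r))) (asc (suc (k + r)) ds))
             (cong₂ _+_ (sum-replicate (suc k) (suc (k + r))) (asc-sum (suc (k + r)) ds))) (full-sum v) ⟩
      suc k * suc (k + r) + (j * suc (k + r) + weight 0 ds) + (k + triangle l + weight 0 v)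
        ≡⟨ lemma l r j (weight 0 ds) (triangle l) (weight 0 v) ⟩
      size (r , v , j , ds) ∎
      where
      open ≡-Reasoning
      lemma : ∀ l r j d t w →
        suc (suc l) * suc (suc l + r) + (j * suc (suc l + r) + d) + (suc l + t + w) ≡
        t + (r + (suc l + (suc (suc l) * suc (suc l) + r * suc l) + (w + (j + ((suc l + r) * j + d)))))
      lemma = solve-∀

    φ-partition : ∀ b → IsPartition (φ b)
    φ-partition (r , v , j , ds) = join-partition k
      (AllPairs.++⁺ (replicate-sorted (suc k) ≤-refl) (asc-ascending _ ds)
        (All.replicate⁺ (suc k) (asc-above _ ds)))
      (upper-> r ds) (full-descending v) (full-below v) (full-positive v)

    Admissible : List ℕ → Set
    Admissible p = AllBelowAreParts (suc k) p ×
      Any.Any (λ s → SmallestPartAbove k p s × multiplicity s p ≥ suc k) p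

    φ-admissible : ∀ b → Admissible (φ b)
    φ-admissible (r , v , j , ds) =
      (λ i<suc[k] 1≤i → ∈-++⁺ʳ (reverse U) (full-∈ v 1≤i (s≤s⁻¹ i<suc[k]))) ,
      lose s∈ ((s≤s (m≤m+n k r) , All.++⁺
        (All-reverse (All.map (λ s≤x _ → s≤x) (upper-≥ r ds)))
        (All.map (λ x≤k k<x → contradiction k<x (≤⇒≯ x≤k)) (full-below v))) , many)
      where
      U = upper r ds
      s = suc (k + r)
      s∈ : s ∈ reverse U ++ full v
      s∈ = ∈-++⁺ˡ (Any.reverse⁺ {xs = U} (here refl))

      many : suc k ≤ multiplicity s (reverse U ++ full v)
      many = begin
        suc k                                      ≡⟨ length-replicate (suc k) ⟨
        length (replicate (suc k) s)               ≡⟨ count-all (_≟ s) (All.replicate⁺ (suc k) refl) ⟨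
        multiplicity s (replicate (suc k) s)       ≤⟨ m≤m+n _ _ ⟩
        multiplicity s (replicate (suc k) s) + multiplicity s (asc s ds) ≡⟨ count-++ (_≟ s) (replicate (suc k) s) (asc s ds) ⟨
        multiplicity s U                           ≤⟨ m≤m+n _ _ ⟩
        multiplicity s U + multiplicity s (full v) ≡⟨ join-count (_≟ s) U (full v) ⟨
        multiplicity s (reverse U ++ full v)       ∎
        where open ≤-Reasoning

    φ-complete : ∀ {p} → IsPartition p → Admissible p → ∃[ b ] φ b ≡ p
    φ-complete {p} (desc , pos) (parts , smallest) with find smallest
    ... | s , s∈ , (k<s , least) , many with m≤n⇒∃[o]m+o≡n k<s | split-at k desc
    ... | r , refl | split U L refl ascending U>k descending L≤k
      with full-surjective k descending (All.++⁻ʳ (reverse U) pos) L≤k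
             (λ 1≤i i≤k → join-∈⁻ U L (∉-above (All.map (≤-trans (s≤s i≤k)) U>k)) (parts (s≤s i≤k) 1≤i))
         | All.zipWith (λ (f , k<x) → f k<x) (All-reverse⁻ U (All.++⁻ˡ (reverse U) least) , U>k)
    ... | v , refl | U≥s with ascending-prefix (suc k) ascending U≥s many′
      where
      many′ : suc k ≤ multiplicity s U
      many′ = subst (suc k ≤_) (trans (join-count (_≟ s) U (full v))
        (trans (cong (multiplicity s U +_) (count-none (_≟ s)
          (All.map (λ { x≤k refl → <⇒≱ k<s x≤k }) (full-below v)))) (+-identityʳ _))) many
    ... | ys , refl with asc-surjective s (proj₂ (AllPairs-++⁻ (replicate (suc k) s) ascending))
                           (All.++⁻ʳ (replicate (suc k) s) U≥s)
    ... | _ , ds , refl = (r , v , _ , ds) , refl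

  P̃-coeff : ∀ n → P̃ k n ≡ coeff (q^ (triangle l) ⊛ Q l k) n
  P̃-coeff = count-partitions
    (λ p → allBelowAreParts? (suc k) p
       ×-dec Any.any? (λ s → smallestPartAbove? k p s ×-dec (multiplicity s p ≥? suc k)) p)
    (Counts-shift (triangle l) (Counts-D λ r → Counts-shift (k + (suc k * suc k + r * k))
      (Counts-× (Counts-weight 0 k) (Counts-D λ j → Counts-shift ((k + r) * j) (Counts-weight 0 j)))))
    φ φ-injective φ-sum φ-partition φ-admissible φ-complete

-- Unimodal compositions

peak-index : ∀ (xs : List ℕ) y ys → ∃[ t ]
  take (suc (toℕ {length (xs ++ y ∷ ys)} t)) (xs ++ y ∷ ys) ≡ xs ++ y ∷ [] ×
  drop (toℕ t) (xs ++ y ∷ ys) ≡ y ∷ ys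
peak-index []       y ys = fzero , refl , refl
peak-index (x ∷ xs) y ys = let t , eq₁ , eq₂ = peak-index xs y ys in fsuc t , cong (x ∷_) eq₁ , eq₂

at-peak : ∀ (c : List ℕ) t → ∃[ xs ] ∃[ y ] ∃[ ys ] c ≡ xs ++ y ∷ ys ×
  take (suc (toℕ {length c} t)) c ≡ xs ++ y ∷ [] × drop (toℕ t) c ≡ y ∷ ys
at-peak (y ∷ ys) fzero    = [] , y , ys , refl , refl , refl
at-peak (x ∷ c)  (fsuc t) = let xs , y , ys , eq , eq₁ , eq₂ = at-peak c t in
  x ∷ xs , y , ys , cong (x ∷_) eq , cong (x ∷_) eq₁ , eq₂

unimodal⁺ : ∀ xs y ys → AllPairs _≤_ (xs ++ y ∷ []) → AllPairs _≥_ (y ∷ ys) → Unimodal (xs ++ y ∷ ys)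
unimodal⁺ xs y ys asc desc = let t , eq₁ , eq₂ = peak-index xs y ys in
  t , subst (Linked _≤_) (sym eq₁) (AllPairs⇒Linked asc) , subst (Linked _≥_) (sym eq₂) (AllPairs⇒Linked desc)

unimodal⁻ : ∀ {c} → Unimodal c → ∃[ xs ] ∃[ y ] ∃[ ys ]
  c ≡ xs ++ y ∷ ys × AllPairs _≤_ (xs ++ y ∷ []) × AllPairs _≥_ (y ∷ ys)
unimodal⁻ {c} (t , asc , desc) = let xs , y , ys , eq , eq₁ , eq₂ = at-peak c t in
  xs , y , ys , eq , Linked⇒AllPairs ≤-trans (subst (Linked _≤_) eq₁ asc) ,
  Linked⇒AllPairs (flip ≤-trans) (subst (Linked _≥_) eq₂ desc)

-- The unimodal compositions with maximum N + 1 occurring i + 1 times.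
unimodal : ∀ N → Vec ℕ N → ℕ → Vec ℕ N → List ℕ
unimodal N α i β = reverse (mult 0 α) ++ mult 0 (suc i ∷ β)

module _ {N} (α : Vec ℕ N) (i : ℕ) (β : Vec ℕ N) where

  unimodal-sum : sum (unimodal N α i β) ≡ suc i * suc N + (weight 0 α + weight 0 β)
  unimodal-sum = trans (join-sum (mult 0 α) (mult 0 (suc i ∷ β)))
    (trans (cong₂ _+_ (mult-sum 0 α) (mult-sum 0 (suc i ∷ β))) (lemma (weight 0 α) (suc i * suc N) (weight 0 β)))
    where
    lemma : ∀ a b c → a + (b + c) ≡ b + (a + c)
    lemma = solve-∀

  unimodal-positive : All (1 ≤_) (unimodal N α i β)
  unimodal-positive = All.++⁺ (All-reverse (mult-above 0 α)) (mult-above 0 (suc i ∷ β))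

  unimodal-unimodal : Unimodal (unimodal N α i β)
  unimodal-unimodal = unimodal⁺ (reverse (mult 0 α)) (suc N) (replicate i (suc N) ++ mult 0 β)
    (AllPairs.++⁺ (AllPairs-reverse (mult-descending 0 α)) ([] ∷ [])
      (All.map (λ x≤N → m≤n⇒m≤1+n x≤N ∷ []) (All-reverse (mult-below 0 α))))
    (mult-descending 0 (suc i ∷ β))

  unimodal-largest : largest (unimodal N α i β) ≡ suc N
  unimodal-largest = ≤-antisym
    (max≤v⁺ {xs = unimodal N α i β} z≤n (All.++⁺ (All.map m≤n⇒m≤1+n (All-reverse (mult-below 0 α))) (mult-below 0 (suc i ∷ β))))
    (All.lookup (xs≤max 0 (unimodal N α i β)) (∈-++⁺ʳ (reverse (mult 0 α)) (here refl)))

  unimodal-multiplicity : multiplicity (largest (unimodal N α i β)) (unimodal N α i β) ≡ suc i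
  unimodal-multiplicity = begin
    multiplicity (largest (unimodal N α i β)) (unimodal N α i β)
      ≡⟨ cong (λ m → multiplicity m (unimodal N α i β)) unimodal-largest ⟩
    multiplicity (suc N) (unimodal N α i β)
      ≡⟨ join-count (_≟ suc N) (mult 0 α) (mult 0 (suc i ∷ β)) ⟩
    multiplicity (suc N) (mult 0 α) + multiplicity (suc N) (replicate (suc i) (suc N) ++ mult 0 β)
      ≡⟨ cong₂ _+_ (absent α) (count-++ (_≟ suc N) (replicate (suc i) (suc N)) (mult 0 β)) ⟩
    multiplicity (suc N) (replicate (suc i) (suc N)) + multiplicity (suc N) (mult 0 β)
      ≡⟨ cong₂ _+_ (count-all (_≟ suc N) (All.replicate⁺ (suc i) refl)) (absent β) ⟩
    length (replicate (suc i) (suc N)) + 0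
      ≡⟨ +-identityʳ _ ⟩
    length (replicate (suc i) (suc N))
      ≡⟨ length-replicate (suc i) ⟩
    suc i ∎
    where
    open ≡-Reasoning
    absent : ∀ (v : Vec ℕ N) → multiplicity (suc N) (mult 0 v) ≡ 0
    absent v = count-none (_≟ suc N) (All.map (<⇒≢ ∘ s≤s) (mult-below 0 v))

-- The largest part determines `N`, and the first occurrence of the maximum separates the left side
-- from the rest.
unimodal-injective : ∀ {N N′ α α′ i i′ β β′} → unimodal N α i β ≡ unimodal N′ α′ i′ β′ →
  _≡_ {A = Σ ℕ λ N → Vec ℕ N × ℕ × Vec ℕ N} (N , α , i , β) (N′ , α′ , i′ , β′)
unimodal-injective {N} {N′} {α} {α′} {i} {i′} {β} {β′} eq
  with suc-injective (trans (sym (unimodal-largest α i β)) (trans (cong largest eq) (unimodal-largest α′ i′ β′)))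
... | refl with ++-injective {P = _< suc N} (mult 0 (suc i ∷ β)) (mult 0 (suc i′ ∷ β′))
                  (All-reverse (All.map s≤s (mult-below 0 α))) (All-reverse (All.map s≤s (mult-below 0 α′)))
                  (<-irrefl refl ∷ []) (<-irrefl refl ∷ []) eq
... | eq₁ , eq₂ with mult-injective 0 α α′ (reverse-injective eq₁) | mult-injective 0 (suc i ∷ β) (suc i′ ∷ β′) eq₂
... | refl | refl = refl

-- Copies of the peak on its left are moved to its right, to make the first maximum the peak.
merge-replicates : ∀ i j {y : ℕ} xs ys →
  reverse (replicate i y ++ xs) ++ (replicate j y ++ ys) ≡ reverse xs ++ (replicate (i + j) y ++ ys)
merge-replicates zero    j xs ys = refl
merge-replicates (suc i) j {y} xs ys = begin
  reverse (y ∷ R) ++ (replicate j y ++ ys)          ≡⟨ ʳ++-defn (y ∷ R) ⟨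
  R ʳ++ (replicate (suc j) y ++ ys)                 ≡⟨ ʳ++-defn R ⟩
  reverse R ++ (replicate (suc j) y ++ ys)          ≡⟨ merge-replicates i (suc j) xs ys ⟩
  reverse xs ++ (replicate (i + suc j) y ++ ys)     ≡⟨ cong (λ m → reverse xs ++ (replicate m y ++ ys)) (+-suc i j) ⟩
  reverse xs ++ (replicate (suc i + j) y ++ ys)     ∎
  where
  open ≡-Reasoning
  R = replicate i y ++ xs

-- The peak provided by `Unimodal` may be any of the maxima. The `i` copies before it and the
-- `suc j` copies from it onwards are merged into one block.
unimodal-complete : ∀ {c} → All (1 ≤_) c → Unimodal c →
  ∃[ N ] ∃[ α ] ∃[ i ] ∃[ β ] unimodal N α i β ≡ c
unimodal-complete pos uni with unimodal⁻ uni
... | xs , y , ys , refl , asc , desc with y | All.++⁻ʳ xs pos | All.++⁻ˡ xs pos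
... | zero | () ∷ _ | _
... | suc N | pos′ | posˡ
  with mult-surjective 0 (suc N) (reverse xs) (AllPairs-reverse (proj₁ (AllPairs-++⁻ xs asc)))
         (All-reverse posˡ) (All-reverse (below xs asc))
     | mult-surjective 0 (suc N) (suc N ∷ ys) desc pos′ (≤-refl ∷ head desc)
  where
  below : ∀ xs {y} → AllPairs _≤_ (xs ++ y ∷ []) → All (_≤ y) xs
  below []       _        = []
  below (x ∷ xs) (ps ∷ asc) = All.head (All.++⁻ʳ xs ps) ∷ below xs asc
  head : ∀ {y ys} → AllPairs _≥_ (y ∷ ys) → All (_≤ y) ys
  head (ps ∷ _) = ps
... | i ∷ α , eq₁ | zero  ∷ β , eq₂ = contradiction (subst (suc N ∈_) (sym eq₂) (here refl)) (∉-below (All.map s≤s (mult-below 0 β)))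
... | i ∷ α , eq₁ | suc j ∷ β , eq₂ = N , α , i + j , β , (begin
  reverse (mult 0 α) ++ (replicate (suc (i + j)) (suc N) ++ mult 0 β)
    ≡⟨ cong (λ m → reverse (mult 0 α) ++ (replicate m (suc N) ++ mult 0 β)) (+-suc i j) ⟨
  reverse (mult 0 α) ++ (replicate (i + suc j) (suc N) ++ mult 0 β)
    ≡⟨ merge-replicates i (suc j) (mult 0 α) (mult 0 β) ⟨
  reverse (replicate i (suc N) ++ mult 0 α) ++ (replicate (suc j) (suc N) ++ mult 0 β)
    ≡⟨ cong₂ _++_ (trans (cong reverse eq₁) (reverse-involutive xs)) eq₂ ⟩
  xs ++ suc N ∷ ys ∎)
  where open ≡-Reasoning

-- The peak `N + 1` has its size from the index of `D` and the shift by 1. The number of further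
-- maxima is the leading entry `i` of the second vector.
u₀-coeff : ∀ n → u 0 n ≡ coeff U₀ n
u₀-coeff n = count-bijection unimodal? (compositions-unique n)
  (Counts-D λ N → Counts-shift 1 (Counts-× (Counts-weight 0 N) (Counts-weight 0 (suc N))))
  (λ { (N , α , i ∷ β) → unimodal N α i β })
  (λ { {N , α , i ∷ β} {N′ , α′ , i′ ∷ β′} eq → inj eq })
  n
  (λ { (N , α , i ∷ β) eq →
    compositions-complete n (unimodal-positive α i β ,
      trans (unimodal-sum α i β) (trans (lemma N (i * suc N) (weight 0 α) (weight 0 β)) eq)) ,
    unimodal-unimodal α i β })
  λ c∈ uni → complete (All.lookup (compositions-sound n) c∈) uni
  where
  inj : ∀ {N N′ α α′ i i′ β β′} → unimodal N α i β ≡ unimodal N′ α′ i′ β′ →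
    _≡_ {A = Σ ℕ λ N → Vec ℕ N × Vec ℕ (suc N)} (N , α , i ∷ β) (N′ , α′ , i′ ∷ β′)
  inj {α = α} {α′} {β = β} {β′} eq with unimodal-injective {α = α} {α′} {β = β} {β′} eq
  ... | refl = refl

  lemma : ∀ N i α β → suc N + i + (α + β) ≡ N + (1 + (α + (i + β)))
  lemma = solve-∀

  complete : ∀ {c} → All (1 ≤_) c × sum c ≡ n → Unimodal c → _
  complete (pos , eq) uni with unimodal-complete pos uni
  ... | N , α , i , β , refl = (N , α , i ∷ β) ,
    trans (sym (trans (unimodal-sum α i β) (lemma N (i * suc N) (weight 0 α) (weight 0 β)))) eq , refl

-- The maxima contribute (i + 1)(N + 1). Subtracting the `suc i` in the size of the compositions
-- leaves N + iN, of which `D` supplies N.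
u-suc-coeff : ∀ i n → u (suc i) n ≡ coeff (D λ N → q^ (i * N) ⊛ (a N ⊛ a N)) n
u-suc-coeff i n = count-bijection
  (λ c → unimodal? c ×-dec (multiplicity (largest c) c ≟ suc i)) (compositions-unique (n + suc i))
  (Counts-D λ N → Counts-shift (i * N) (Counts-× (Counts-weight 0 N) (Counts-weight 0 N)))
  (λ (N , α , β) → unimodal N α i β)
  (λ { {N , α , β} {N′ , α′ , β′} eq → inj eq })
  n
  (λ { (N , α , β) eq →
    compositions-complete (n + suc i) (unimodal-positive α i β ,
      trans (unimodal-sum α i β) (trans (lemma N i (weight 0 α) (weight 0 β)) (cong (_+ suc i) eq))) ,
    unimodal-unimodal α i β , unimodal-multiplicity α i β })
  λ c∈ (uni , eq) → complete (All.lookup (compositions-sound (n + suc i)) c∈) uni eq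
  where
  inj : ∀ {N N′ α α′ β β′} → unimodal N α i β ≡ unimodal N′ α′ i β′ →
    _≡_ {A = Σ ℕ λ N → Vec ℕ N × Vec ℕ N} (N , α , β) (N′ , α′ , β′)
  inj {α = α} {α′} {β} {β′} eq with unimodal-injective {α = α} {α′} {i} {i} {β} {β′} eq
  ... | refl = refl

  lemma : ∀ N i α β → suc i * suc N + (α + β) ≡ N + (i * N + (α + β)) + suc i
  lemma = solve-∀

  complete : ∀ {c} → All (1 ≤_) c × sum c ≡ n + suc i → Unimodal c → multiplicity (largest c) c ≡ suc i → _
  complete (pos , eq) uni eq′ with unimodal-complete pos uni
  ... | N , α , i′ , β , refl with suc-injective (trans (sym (unimodal-multiplicity α i′ β)) eq′)
  ... | refl = (N , α , β) , +-cancelʳ-≡ (suc i) _ _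
    (trans (sym (trans (unimodal-sum α i β) (lemma N i (weight 0 α) (weight 0 β)))) eq) , refl

open import Data.Integer as ℤ using (ℤ; +_; -[1+_])
import Data.Integer.Properties as ℤ
import Data.Integer.Tactic.RingSolver as ℤ-Solver

-- The crank

+[b+e]-+b≡+e : ∀ b e → + (b + e) ℤ.- + b ≡ + e
+[b+e]-+b≡+e b e = begin
  + (b + e) ℤ.- + b          ≡⟨ cong (ℤ._- + b) (ℤ.pos-+ b e) ⟩
  + b ℤ.+ + e ℤ.- + b        ≡⟨ cong (ℤ._- + b) (ℤ.+-comm (+ b) (+ e)) ⟩
  + e ℤ.+ + b ℤ.- + b        ≡⟨ ℤ.+-assoc (+ e) (+ b) (ℤ.- + b) ⟩
  + e ℤ.+ (+ b ℤ.- + b)      ≡⟨ cong (ℤ._+_ (+ e)) (ℤ.+-inverseʳ (+ b)) ⟩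
  + e ℤ.+ + 0                ≡⟨ ℤ.+-identityʳ (+ e) ⟩
  + e                        ∎
  where open ≡-Reasoning

+a-+b≡+e⇒a≡b+e : ∀ a b e → + a ℤ.- + b ≡ + e → a ≡ b + e
+a-+b≡+e⇒a≡b+e a b e eq = ℤ.+-injective (begin
  + a                            ≡⟨ ℤ.+-identityʳ (+ a) ⟨
  + a ℤ.+ + 0                    ≡⟨ cong (ℤ._+_ (+ a)) (ℤ.+-inverseˡ (+ b)) ⟨
  + a ℤ.+ (ℤ.- + b ℤ.+ + b)      ≡⟨ ℤ.+-assoc (+ a) (ℤ.- + b) (+ b) ⟨
  + a ℤ.- + b ℤ.+ + b            ≡⟨ cong (ℤ._+ + b) eq ⟩
  + e ℤ.+ + b                    ≡⟨ ℤ.+-comm (+ e) (+ b) ⟩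
  + b ℤ.+ + e                    ≡⟨ ℤ.pos-+ b e ⟨
  + (b + e)                      ∎)
  where open ≡-Reasoning

0<i⇒i≡+suc : ∀ {i} → + 0 ℤ.< i → ∃[ d ] i ≡ + suc d
0<i⇒i≡+suc {+ suc d} (ℤ.+<+ _) = d , refl
0<i⇒i≡+suc {+ zero} (ℤ.+<+ ())

crank-withoutOnes : ∀ p → ω p ≡ 0 → crank p ≡ + largest p
crank-withoutOnes p eq with ω p | eq
... | zero | _ = refl

crank-withOnes : ∀ p w → ω p ≡ suc w → crank p ≡ + count (_>? suc w) p ℤ.- + suc w
crank-withOnes p w eq with ω p | eq
... | _ | refl = cong (λ v → + count (_>? v) p ℤ.- + suc w) eq

zero∨suc : ∀ n → n ≡ 0 ⊎ ∃[ m ] n ≡ suc m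
zero∨suc zero    = inj₁ refl
zero∨suc (suc m) = inj₂ (m , refl)

1∉⇒2≤ : ∀ {p} → All (1 ≤_) p → ω p ≡ 0 → All (2 ≤_) p
1∉⇒2≤ {p} pos eq = All.tabulate λ i∈ → ≤∧≢⇒< (All.lookup pos i∈)
  λ { refl → contradiction (subst (1 ≤_) eq (nonempty (∈-filter⁺ (_≟ 1) i∈ refl))) λ () }
  where
  nonempty : ∀ {x : ℕ} {xs : List ℕ} → x ∈ xs → 1 ≤ length xs
  nonempty (here _)  = s≤s z≤n
  nonempty (there _) = s≤s z≤n

module WithOnes (w : ℕ) where

  lower : Vec ℕ w → List ℕ
  lower v = mult 1 v ++ replicate (suc w) 1

  -- Parts above `suc w` are given by differences, parts from 2 to `suc w` by multiplicities, and
  -- then there are `suc w` ones. The length `m` is thus the `μ` of the partition, and its crank is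
  -- m - (w + 1).
  partition : Vec ℕ w → ∀ {m} → Vec ℕ m → List ℕ
  partition v ds = reverse (asc (suc (suc w)) ds) ++ lower v

  lower-below : ∀ v → All (_≤ suc w) (lower v)
  lower-below v = All.++⁺ (mult-below 1 v) (All.replicate⁺ (suc w) (s≤s z≤n))

  partition-isPartition : ∀ v {m} (ds : Vec ℕ m) → IsPartition (partition v ds)
  partition-isPartition v ds = join-partition (suc w) (asc-ascending _ ds) (asc-above _ ds)
    (++-descending (mult-descending 1 v) (replicate-sorted (suc w) ≤-refl)
      (All.map <⇒≤ (mult-above 1 v)) (All.replicate⁺ (suc w) ≤-refl))
    (lower-below v)
    (All.++⁺ (All.map <⇒≤ (mult-above 1 v)) (All.replicate⁺ (suc w) ≤-refl))

  partition-sum : ∀ v {m} (ds : Vec ℕ m) →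
    sum (partition v ds) ≡ m * suc (suc w) + weight 0 ds + (weight 1 v + suc w)
  partition-sum v ds = trans (join-sum (asc (suc (suc w)) ds) (lower v)) (cong₂ _+_ (asc-sum (suc (suc w)) ds)
    (trans (sum-++ (mult 1 v) _)
      (cong₂ _+_ (mult-sum 1 v) (trans (sum-replicate (suc w) 1) (*-identityʳ (suc w))))))

  -- The number of ones is left arbitrary for the sake of `partition-complete`, where it has to be
  -- computed before it is known to be `suc w`.
  partition-ω′ : ∀ (v : Vec ℕ w) i {m} (ds : Vec ℕ m) →
    ω (reverse (asc (suc (suc w)) ds) ++ (mult 1 v ++ replicate i 1)) ≡ i
  partition-ω′ v i ds = begin
    ω (reverse U ++ (mult 1 v ++ replicate i 1))
      ≡⟨ join-count (_≟ 1) U _ ⟩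
    ω U + ω (mult 1 v ++ replicate i 1)
      ≡⟨ cong₂ _+_ (count-none (_≟ 1) (All.map (λ { (s≤s ()) refl }) (asc-above (suc (suc w)) ds)))
                   (count-++ (_≟ 1) (mult 1 v) _) ⟩
    ω (mult 1 v) + ω (replicate i 1)
      ≡⟨ cong₂ _+_ (count-none (_≟ 1) (All.map (λ { (s≤s ()) refl }) (mult-above 1 v)))
                   (count-all (_≟ 1) (All.replicate⁺ i refl)) ⟩
    length (replicate i 1)
      ≡⟨ length-replicate i ⟩
    i ∎
    where
    open ≡-Reasoning
    U = asc (suc (suc w)) ds

  partition-ω : ∀ v {m} (ds : Vec ℕ m) → ω (partition v ds) ≡ suc w
  partition-ω v = partition-ω′ v (suc w)

  partition-μ : ∀ v {m} (ds : Vec ℕ m) → count (_>? suc w) (partition v ds) ≡ m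
  partition-μ v ds = trans (join-count (_>? suc w) (asc (suc (suc w)) ds) (lower v))
    (trans (cong₂ _+_ (count-all (_>? suc w) (asc-above (suc (suc w)) ds))
                      (count-none (_>? suc w) (All.map ≤⇒≯ (lower-below v))))
    (trans (+-identityʳ _) (asc-length (suc (suc w)) ds)))

  partition-crank : ∀ v {e} (ds : Vec ℕ (suc w + e)) → crank (partition v ds) ≡ + e
  partition-crank v {e} ds = trans (crank-withOnes (partition v ds) w (partition-ω v ds))
    (trans (cong (λ m → + m ℤ.- + suc w) (partition-μ v ds)) (+[b+e]-+b≡+e (suc w) e))

  partition-injective : ∀ v v′ {m m′} (ds : Vec ℕ m) (ds′ : Vec ℕ m′) →
    partition v ds ≡ partition v′ ds′ → v ≡ v′ × asc (suc (suc w)) ds ≡ asc (suc (suc w)) ds′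
  partition-injective v v′ ds ds′ eq =
    let eq₁ , eq₂ = join-injective (suc w) (asc-above _ ds) (asc-above _ ds′) (lower-below v) (lower-below v′) eq
    in mult-injective 1 v v′ (++-cancelʳ (replicate (suc w) 1) _ _ eq₂) , eq₁

  unsnoc-ones : ∀ {w} (v : Vec ℕ (suc w)) →
    ∃[ v′ ] ∃[ i ] mult 0 v ≡ mult 1 {w} v′ ++ replicate i 1
  unsnoc-ones {zero}  (i ∷ []) = [] , i , ++-identityʳ _
  unsnoc-ones {suc w} (j ∷ v)  = let v′ , i , eq = unsnoc-ones v in
    j ∷ v′ , i , trans (cong (replicate j (suc (suc w)) ++_) eq) (sym (++-assoc (replicate j _) (mult 1 v′) _))

  -- Cutting at `suc w` gives both vectors. The number of ones then fixes `i`, and the crank fixes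
  -- the number of large parts as `suc w + e`.
  partition-complete : ∀ {p e} → IsPartition p → ω p ≡ suc w → crank p ≡ + e →
    ∃[ v ] Σ (Vec ℕ (suc w + e)) λ ds → partition v ds ≡ p
  partition-complete {e = e} (desc , pos) ω≡ crank≡ with split-at (suc w) desc
  ... | split U L refl ascending above descending below
    with mult-surjective 0 (suc w) L descending (All.++⁻ʳ (reverse U) pos) below
  ... | v , refl with unsnoc-ones v | asc-surjective (suc (suc w)) ascending above
  ... | v′ , i , eq | m , ds , refl rewrite eq with trans (sym (partition-ω′ v′ i ds)) ω≡
  ... | refl with trans (sym (partition-μ v′ ds)) (+a-+b≡+e⇒a≡b+e _ (suc w) e
                    (trans (sym (crank-withOnes (partition v′ ds) w (partition-ω v′ ds))) crank≡))
  ... | refl = v′ , ds , refl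

open WithOnes

partition-ω-injective : ∀ {w w′} v v′ {m m′} (ds : Vec ℕ m) (ds′ : Vec ℕ m′) →
  partition w v ds ≡ partition w′ v′ ds′ → w ≡ w′
partition-ω-injective {w} {w′} v v′ ds ds′ eq =
  suc-injective (trans (sym (partition-ω w v ds)) (trans (cong ω eq) (partition-ω w′ v′ ds′)))

Counts-K : ∀ e → (λ ((w , v , ds) : Σ ℕ λ w → Vec ℕ w × Vec ℕ (suc w + e)) →
  w + (1 + (suc w + suc w * (suc w + e)) + (weight 1 v + weight 0 ds))) Counts K e
Counts-K e = Counts-D λ w → Counts-shift (1 + (suc w + suc w * (suc w + e)))
  (Counts-× (Counts-weight 1 w) (Counts-weight 0 (suc w + e)))

-- The left side is the sum of the partition; the summand `e` on the right is the factor q^e that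
-- `K e` lacks.
K-size : ∀ w e v d → (suc w + e) * suc (suc w) + d + (v + suc w) ≡
                     e + (w + (1 + (suc w + suc w * (suc w + e)) + (v + d)))
K-size = solve-∀

withoutOnes-ω : ∀ {m} (ds : Vec ℕ m) → ω (reverse (asc 2 ds)) ≡ 0
withoutOnes-ω ds = trans (count-reverse (_≟ 1) (asc 2 ds))
  (count-none (_≟ 1) (All.map (λ { (s≤s ()) refl }) (asc-above 2 ds)))

≤largest : ∀ {x} p → x ∈ p → x ≤ largest p
≤largest p = All.lookup (xs≤max 0 p)

crankPositive-coeff : ∀ n → count (λ p → + 0 ℤ.<? crank p) (partitions n) ≡ coeff crankPositive n
crankPositive-coeff = count-partitions (λ p → + 0 ℤ.<? crank p)
  (Counts-⊎ (Counts-D λ m → Counts-shift (2 + m) (Counts-weight 0 (suc m)))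
            (Counts-D λ d → Counts-shift 1 (Counts-K (suc d))))
  φ φ-injective φ-sum φ-partition φ-positive φ-complete
  where
  Object : Set
  Object = (Σ ℕ λ m → Vec ℕ (suc m)) ⊎ (Σ ℕ λ d → Σ ℕ λ w → Vec ℕ w × Vec ℕ (suc w + suc d))

  φ : Object → List ℕ
  φ (inj₁ (m , ds))         = reverse (asc 2 ds)
  φ (inj₂ (d , w , v , ds)) = partition w v ds

  φ-injective : ∀ {b c} → φ b ≡ φ c → b ≡ c
  φ-injective {inj₁ (m , ds)} {inj₁ (m′ , ds′)} eq with reverse-injective {x = asc 2 ds} {y = asc 2 ds′} eq
  ... | eq′ with suc-injective (trans (sym (asc-length 2 ds)) (trans (cong length eq′) (asc-length 2 ds′)))
  ... | refl = cong (λ ds → inj₁ (m , ds)) (asc-injective 2 ds ds′ eq′)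
  φ-injective {inj₁ (m , ds)} {inj₂ (d , w , v , ds′)} eq =
    contradiction (trans (sym (withoutOnes-ω ds)) (trans (cong ω eq) (partition-ω w v ds′))) λ ()
  φ-injective {inj₂ (d , w , v , ds′)} {inj₁ (m , ds)} eq =
    contradiction (trans (sym (withoutOnes-ω ds)) (trans (cong ω (sym eq)) (partition-ω w v ds′))) λ ()
  φ-injective {inj₂ (d , w , v , ds)} {inj₂ (d′ , w′ , v′ , ds′)} eq with partition-ω-injective v v′ ds ds′ eq
  ... | refl with partition-injective w v v′ ds ds′ eq
  ... | refl , eq′ with suc-injective (+-cancelˡ-≡ (suc w) (suc d) (suc d′)
      (trans (sym (asc-length (suc (suc w)) ds)) (trans (cong length eq′) (asc-length (suc (suc w)) ds′))))
  ... | refl = cong (λ ds → inj₂ (d , w , v , ds)) (asc-injective (suc (suc w)) ds ds′ eq′)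

  φ-sum : ∀ b → sum (φ b) ≡ _
  φ-sum (inj₁ (m , ds)) = trans (sum-reverse (asc 2 ds)) (trans (asc-sum 2 ds) (lemma m (weight 0 ds)))
    where
    lemma : ∀ m d → suc m * 2 + d ≡ m + (2 + m + d)
    lemma = solve-∀
  φ-sum (inj₂ (d , w , v , ds)) = trans (partition-sum w v ds)
    (trans (K-size w (suc d) (weight 1 v) (weight 0 ds)) (sym (+-suc d _)))

  φ-partition : ∀ b → IsPartition (φ b)
  φ-partition (inj₁ (m , ds)) = AllPairs-reverse (asc-ascending 2 ds) , All-reverse (All.map <⇒≤ (asc-above 2 ds))
  φ-partition (inj₂ (d , w , v , ds)) = partition-isPartition w v ds

  φ-positive : ∀ b → + 0 ℤ.< crank (φ b)
  φ-positive (inj₁ (m , i ∷ ds)) = subst (+ 0 ℤ.<_) (sym (crank-withoutOnes p (withoutOnes-ω (i ∷ ds))))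
    (ℤ.+<+ (≤-trans (s≤s z≤n) (≤largest p (Any.reverse⁺ {xs = asc 2 (i ∷ ds)} (here refl)))))
    where p = reverse (asc 2 (i ∷ ds))
  φ-positive (inj₂ (d , w , v , ds)) = subst (+ 0 ℤ.<_) (sym (partition-crank w v ds)) (ℤ.+<+ (s≤s z≤n))

  φ-complete : ∀ {p} → IsPartition p → + 0 ℤ.< crank p → ∃[ b ] φ b ≡ p
  φ-complete {p} (desc , pos) crank>0 with zero∨suc (ω p) | 0<i⇒i≡+suc crank>0
  ... | inj₂ (w , ω≡) | d , crank≡ = let v , ds , eq = partition-complete w (desc , pos) ω≡ crank≡
                                     in inj₂ (d , w , v , ds) , eq
  ... | inj₁ ω≡ | d , crank≡ with asc-surjective 2 (AllPairs-reverse desc) (All-reverse (1∉⇒2≤ pos ω≡))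
  ...   | suc m , ds , eq = inj₁ (m , ds) , trans (cong reverse eq) (reverse-involutive p)
  -- The empty partition has no ones either, but its crank is 0.
  ...   | zero , [] , eq with reverse-injective {x = []} {y = p} eq
  ...     | refl = contradiction crank>0 λ { (ℤ.+<+ ()) }

crankZero-coeff : ∀ n → count (λ p → crank p ℤ.≟ + 0) (partitions n) ≡ coeff crankZero n
crankZero-coeff = count-partitions (λ p → crank p ℤ.≟ + 0)
  (Counts-⊎ (Counts-q^ 0) (Counts-K 0)) φ φ-injective φ-sum φ-partition φ-zero φ-complete
  where
  Object : Set
  Object = ⊤ ⊎ (Σ ℕ λ w → Vec ℕ w × Vec ℕ (suc w + 0))

  φ : Object → List ℕ
  φ (inj₁ _)            = []
  φ (inj₂ (w , v , ds)) = partition w v ds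

  φ-injective : ∀ {b c} → φ b ≡ φ c → b ≡ c
  φ-injective {inj₁ _} {inj₁ _} _ = refl
  φ-injective {inj₁ _} {inj₂ (w , v , ds)} eq =
    contradiction (trans (cong ω eq) (partition-ω w v ds)) λ ()
  φ-injective {inj₂ (w , v , ds)} {inj₁ _} eq =
    contradiction (trans (cong ω (sym eq)) (partition-ω w v ds)) λ ()
  φ-injective {inj₂ (w , v , ds)} {inj₂ (w′ , v′ , ds′)} eq with partition-ω-injective v v′ ds ds′ eq
  ... | refl with partition-injective w v v′ ds ds′ eq
  ... | refl , eq′ = cong (λ ds → inj₂ (w , v , ds)) (asc-injective (suc (suc w)) ds ds′ eq′)

  φ-sum : ∀ b → sum (φ b) ≡ _
  φ-sum (inj₁ _)            = refl
  φ-sum (inj₂ (w , v , ds)) = trans (partition-sum w v ds) (K-size w 0 (weight 1 v) (weight 0 ds))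

  φ-partition : ∀ b → IsPartition (φ b)
  φ-partition (inj₁ _)            = [] , []
  φ-partition (inj₂ (w , v , ds)) = partition-isPartition w v ds

  φ-zero : ∀ b → crank (φ b) ≡ + 0
  φ-zero (inj₁ _)            = refl
  φ-zero (inj₂ (w , v , ds)) = partition-crank w v ds

  φ-complete : ∀ {p} → IsPartition p → crank p ≡ + 0 → ∃[ b ] φ b ≡ p
  φ-complete {p} part crank≡ with zero∨suc (ω p)
  ... | inj₂ (w , ω≡) = let v , ds , eq = partition-complete w part ω≡ crank≡ in inj₂ (w , v , ds) , eq
  φ-complete {[]}    part           crank≡ | inj₁ ω≡ = inj₁ tt , refl
  -- Without ones the crank is the largest part, which is positive in a nonempty partition.
  φ-complete {i ∷ p} (_ , 1≤i ∷ _) crank≡ | inj₁ ω≡ = contradiction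
    (≤-trans 1≤i (subst (i ≤_) (ℤ.+-injective (trans (sym (crank-withoutOnes (i ∷ p) ω≡)) crank≡))
      (≤largest (i ∷ p) (here refl)))) λ ()

crankNonneg-coeff : ∀ n →
  count (λ p → + 0 ℤ.≤? crank p) (partitions n) ≡ coeff (crankPositive ⊕ crankZero) n
crankNonneg-coeff n = trans (split-count (partitions n)) (cong₂ _+_ (crankPositive-coeff n) (crankZero-coeff n))
  where
  split-count : ∀ ps → count (λ p → + 0 ℤ.≤? crank p) ps ≡
                count (λ p → + 0 ℤ.<? crank p) ps + count (λ p → crank p ℤ.≟ + 0) ps
  split-count []       = refl
  split-count (p ∷ ps) with crank p
  ... | + zero   = trans (cong suc (split-count ps)) (sym (+-suc _ _))
  ... | + suc _  = cong suc (split-count ps)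
  ... | -[1+ _ ] = split-count ps

-- Convolution with C

q^-shift : ∀ t f n → coeff (q^ t ⊛ f) (n + t) ≡ coeff f n
q^-shift zero    f n = trans (at (⊛-identityˡ f) (n + 0)) (cong (coeff f) (+-identityʳ n))
q^-shift (suc t) f n = trans (cong (coeff (q^ (suc t) ⊛ f)) (+-suc n t)) (q^-shift t f n)

-- The term that `partialSum` adds last has the greatest `j`, hence `i = 0`, and is the first one in
-- the antidiagonal sum.
partialSum-∑ : ∀ n f (g h : ℕ → ℕ → ℕ) → (∀ i j → i + j ≡ n → f j ≡ + g i j ℤ.- + h i j) →
  partialSum f (suc n) ≡ + ∑⟨ g ⟩ n ℤ.- + ∑⟨ h ⟩ n
partialSum-∑ zero    f g h eq = trans (ℤ.+-identityˡ (f 0)) (eq 0 0 refl)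
partialSum-∑ (suc n) f g h eq = begin
  partialSum f (suc n) ℤ.+ f (suc n)
    ≡⟨ cong₂ ℤ._+_ (partialSum-∑ n f (g ∘ suc) (h ∘ suc) λ i j p → eq (suc i) j (cong suc p)) (eq 0 (suc n) refl) ⟩
  + G′ ℤ.- + H′ ℤ.+ (+ g₀ ℤ.- + h₀)
    ≡⟨ lemma (+ G′) (+ H′) (+ g₀) (+ h₀) ⟩
  (+ g₀ ℤ.+ + G′) ℤ.- (+ h₀ ℤ.+ + H′)
    ≡⟨ cong₂ ℤ._-_ (ℤ.pos-+ g₀ G′) (ℤ.pos-+ h₀ H′) ⟨
  + (g₀ + G′) ℤ.- + (h₀ + H′) ∎
  where
  open ≡-Reasoning
  G′ = ∑⟨ g ∘ suc ⟩ n
  H′ = ∑⟨ h ∘ suc ⟩ n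
  g₀ = g 0 (suc n)
  h₀ = h 0 (suc n)
  lemma : ∀ a b c d → a ℤ.- b ℤ.+ (c ℤ.- d) ≡ (c ℤ.+ a) ℤ.- (d ℤ.+ b)
  lemma = ℤ-Solver.solve-∀

partialSum-stable : ∀ f N → (∀ j → N ≤ j → f j ≡ + 0) → ∀ N′ → N ≤ N′ → partialSum f N′ ≡ partialSum f N
partialSum-stable f N vanish N′ N≤N′ with m≤n⇒∃[o]m+o≡n N≤N′
... | t , refl = go t
  where
  go : ∀ t → partialSum f (N + t) ≡ partialSum f N
  go zero    = cong (partialSum f) (+-identityʳ N)
  go (suc t) = trans (cong (partialSum f) (+-suc N t))
    (trans (cong₂ ℤ._+_ (go t) (vanish (N + t) (m≤m+n N t))) (ℤ.+-identityʳ _))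

triangle-double : ∀ l → triangle l * 2 ≡ l * suc l
triangle-double zero    = refl
triangle-double (suc l) = trans (*-distribʳ-+ 2 (suc l) (triangle l))
  (trans (cong (λ t → suc l * 2 + t) (triangle-double l)) (lemma l))
  where
  lemma : ∀ l → suc l * 2 + l * suc l ≡ suc l * suc (suc l)
  lemma = solve-∀

-- With k = l + 1 this is k(3k+1)/2 = k(k-1)/2 + (k+1)k. The numerator is shown to be twice the
-- right-hand side, so the division is exact.
pentagonal : ∀ l → (suc l * (3 * suc l + 1)) / 2 ≡ triangle l + suc (suc l) * suc l
pentagonal l = trans (cong (_/ 2) (begin
  suc l * (3 * suc l + 1)                         ≡⟨ lemma l ⟩
  l * suc l + suc (suc l) * suc l * 2             ≡⟨ cong (λ t → t + suc (suc l) * suc l * 2) (triangle-double l) ⟨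
  triangle l * 2 + suc (suc l) * suc l * 2        ≡⟨ *-distribʳ-+ 2 (triangle l) _ ⟨
  (triangle l + suc (suc l) * suc l) * 2          ∎)) (m*n/n≡m _ 2)
  where
  open ≡-Reasoning
  lemma : ∀ l → suc l * (3 * suc l + 1) ≡ l * suc l + suc (suc l) * suc l * 2
  lemma = solve-∀

M+P̃-coeff : ∀ l j → M (suc l) j + P̃ (suc l) j ≡ coeff (q^ ((suc l * (3 * suc l + 1)) / 2) ⊛ G 0) j
M+P̃-coeff l j = trans (cong₂ _+_ (M-coeff l j) (P̃-coeff l j))
  (trans (at (truncated-pentagonal l (triangle l)) j)
         (cong (λ t → coeff (q^ t ⊛ G 0) j) (sym (pentagonal l))))

-- `C` as a difference of series over ℕ. The partition of 1 has crank -1, so all three counts are 0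
-- at 1, and the conventional values 1, 0, -1 require adding q, nothing, and subtracting q.
C⁺ C⁻ : Fin 3 → Series
C⁺ fzero               = crankPositive ⊕ q^ 1
C⁺ (fsuc fzero)        = crankPositive ⊕ crankZero
C⁺ (fsuc (fsuc fzero)) = crankZero
C⁻ fzero               = 𝟘
C⁻ (fsuc fzero)        = 𝟘
C⁻ (fsuc (fsuc fzero)) = q^ 1

C-coeff : ∀ m i → C m (+ i) ≡ + coeff (C⁺ m) i ℤ.- + coeff (C⁻ m) i
C-coeff fzero 0 = trans (cong +_ (trans (crankPositive-coeff 0) (sym (+-identityʳ _)))) (sym (ℤ.+-identityʳ _))
C-coeff fzero 1 = cong (λ c → + (c + 1) ℤ.- + 0) (crankPositive-coeff 1)
C-coeff fzero (suc (suc i)) = trans (cong +_ (trans (crankPositive-coeff (suc (suc i))) (sym (+-identityʳ _)))) (sym (ℤ.+-identityʳ _))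
C-coeff (fsuc fzero) 0 = trans (cong +_ (crankNonneg-coeff 0)) (sym (ℤ.+-identityʳ _))
C-coeff (fsuc fzero) 1 = trans (cong +_ (crankNonneg-coeff 1)) (sym (ℤ.+-identityʳ _))
C-coeff (fsuc fzero) (suc (suc i)) = trans (cong +_ (crankNonneg-coeff (suc (suc i)))) (sym (ℤ.+-identityʳ _))
C-coeff (fsuc (fsuc fzero)) 0 = trans (cong +_ (crankZero-coeff 0)) (sym (ℤ.+-identityʳ _))
C-coeff (fsuc (fsuc fzero)) 1 = cong (λ c → + c ℤ.- + 1) (crankZero-coeff 1)
C-coeff (fsuc (fsuc fzero)) (suc (suc i)) = trans (cong +_ (crankZero-coeff (suc (suc i)))) (sym (ℤ.+-identityʳ _))

U : Fin 3 → Series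
U fzero               = U₀
U (fsuc fzero)        = U₁
U (fsuc (fsuc fzero)) = U₂

u-coeff : ∀ m n → u (toℕ m) n ≡ coeff (U m) n
u-coeff fzero               n = u₀-coeff n
u-coeff (fsuc fzero)        n = trans (u-suc-coeff 0 n) (at (D-cong {λ N → q^ (0 * N) ⊛ (a N ⊛ a N)} λ N → ⊛-identityˡ (a N ⊛ a N)) n)
u-coeff (fsuc (fsuc fzero)) n = trans (u-suc-coeff 1 n)
  (at (D-cong {λ N → q^ (1 * N) ⊛ (a N ⊛ a N)} λ N → ⊛-congʳ (≈-reflexive (cong q^ (*-identityˡ N)))) n)

⊕-⊛-𝟘 : ∀ f g → f ≈ f ⊕ g ⊛ 𝟘
⊕-⊛-𝟘 = solve 2 (λ f g → f := f :+ g :* con 0) ≈-refl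

C-⊛-G : ∀ m → G 0 ⊛ C⁺ m ≈ U m ⊕ G 0 ⊛ C⁻ m
C-⊛-G fzero               = ≈-trans crankPositive-⊛-G (⊕-⊛-𝟘 U₀ (G 0))
C-⊛-G (fsuc fzero)        = ≈-trans crankNonneg-⊛-G (⊕-⊛-𝟘 U₁ (G 0))
C-⊛-G (fsuc (fsuc fzero)) = crankZero-⊛-G

corollary1p7 : ∀ (k n : ℕ) → 1 ≤ k → 1 ≤ n → (m : Fin 3) →
    HasSum (λ j → C m (+ (n + (k * (3 * k + 1)) / 2) ℤ.- + j) ℤ.* + (M k j + P̃ k j))
    (+ u (toℕ m) n)
corollary1p7 (suc l) n _ _ m = suc N , λ N′ N<N′ → trans (partialSum-stable f (suc N) beyond N′ N<N′) total
  where
  T = (suc l * (3 * suc l + 1)) / 2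
  N = n + T
  W = q^ T ⊛ G 0

  f : ℕ → ℤ
  f j = C m (+ N ℤ.- + j) ℤ.* + (M (suc l) j + P̃ (suc l) j)

  -- Here the argument of `C` is negative, so its conventional value 0 ends the series.
  beyond : ∀ j → N < j → f j ≡ + 0
  beyond j N<j with m≤n⇒∃[o]m+o≡n N<j
  ... | o , refl = cong (ℤ._* + (M (suc l) j + P̃ (suc l) j)) (cong (C m) (begin
    + N ℤ.- + (suc N + o)         ≡⟨ ℤ.m-n≡m⊖n N (suc N + o) ⟩
    N ℤ.⊖ (suc N + o)             ≡⟨ ℤ.⊖-< N<j ⟩
    ℤ.- + (suc N + o ∸ N)         ≡⟨ cong (λ t → ℤ.- + t) (trans (cong (_∸ N) (sym (+-suc N o))) (m+n∸m≡n N (suc o))) ⟩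
    -[1+ o ]                      ∎))
    where open ≡-Reasoning

  term : ∀ i j → i + j ≡ N →
    f j ≡ + (coeff (C⁺ m) i * coeff W j) ℤ.- + (coeff (C⁻ m) i * coeff W j)
  term i j eq = begin
    C m (+ N ℤ.- + j) ℤ.* + (M (suc l) j + P̃ (suc l) j)
      ≡⟨ cong₂ (λ c w → C m c ℤ.* + w) index (M+P̃-coeff l j) ⟩
    C m (+ i) ℤ.* + coeff W j
      ≡⟨ cong (ℤ._* + coeff W j) (C-coeff m i) ⟩
    (+ coeff (C⁺ m) i ℤ.- + coeff (C⁻ m) i) ℤ.* + coeff W j
      ≡⟨ lemma (+ coeff (C⁺ m) i) (+ coeff (C⁻ m) i) (+ coeff W j) ⟩
    + coeff (C⁺ m) i ℤ.* + coeff W j ℤ.- + coeff (C⁻ m) i ℤ.* + coeff W j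
      ≡⟨ cong₂ ℤ._-_ (ℤ.pos-* (coeff (C⁺ m) i) (coeff W j)) (ℤ.pos-* (coeff (C⁻ m) i) (coeff W j)) ⟨
    + (coeff (C⁺ m) i * coeff W j) ℤ.- + (coeff (C⁻ m) i * coeff W j) ∎
    where
    open ≡-Reasoning
    lemma : ∀ a b c → (a ℤ.- b) ℤ.* c ≡ a ℤ.* c ℤ.- b ℤ.* c
    lemma = ℤ-Solver.solve-∀
    index : + N ℤ.- + j ≡ + i
    index = subst (λ t → + t ℤ.- + j ≡ + i) (trans (+-comm j i) eq) (+[b+e]-+b≡+e j i)

  -- The factor q^T in `W` lowers the coefficient index from `N = n + T` to `n`.
  shift : ∀ c → coeff (c ⊛ W) N ≡ coeff (G 0 ⊛ c) n
  shift c = trans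
    (at (solve 3 (λ c y g → c :* (y :* g) := y :* (g :* c)) ≈-refl c (q^ T) (G 0)) N)
    (q^-shift T (G 0 ⊛ c) n)

  total : partialSum f (suc N) ≡ + u (toℕ m) n
  total = begin
    partialSum f (suc N)
      ≡⟨ partialSum-∑ N f _ _ term ⟩
    + coeff (C⁺ m ⊛ W) N ℤ.- + coeff (C⁻ m ⊛ W) N
      ≡⟨ cong₂ (λ a b → + a ℤ.- + b) (trans (shift (C⁺ m)) (at (C-⊛-G m) n)) (shift (C⁻ m)) ⟩
    -- By `C-⊛-G`, the positive part exceeds `U m` by exactly the contribution `e` of `C⁻ m`, which
    -- cancels.
    + (coeff (U m) n + e) ℤ.- + e
      ≡⟨ trans (cong (λ t → + t ℤ.- + e) (+-comm (coeff (U m) n) e)) (+[b+e]-+b≡+e e (coeff (U m) n)) ⟩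
    + coeff (U m) n
      ≡⟨ cong +_ (u-coeff m n) ⟨
    + u (toℕ m) n ∎
    where
    open ≡-Reasoning
    e = coeff (G 0 ⊛ C⁻ m) n
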